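{- Let $T$ be a complete first-order theory, let $\mathfrak{C}\prec\mathfrak{C}'$, $\bar c$, $EL$, the minimal left ideal $\mathcal{M}\subseteq EL$, the idempotent $u\in\mathcal{M}$, the $\tau$-topology on $u\mathcal{M}$, the subgroup $H(u\mathcal{M})$, and the group epimorphism $f\colon u\mathcal{M}\to \mathrm{Gal}_L(T)$ be as defined in the context. Suppose that $u\mathcal{M}$ is equipped with the $\tau$-topology and $u\mathcal{M}/H(u\mathcal{M})$ with the induced quotient topology. Then: (1) $f$ is continuous. (2) $H(u\mathcal{M})\leq \ker(f)$. (3) The formula $pH(u\mathcal{M})\mapsto f(p)$ yields a well-defined continuous epimorphism $\bar f$ from $u\mathcal{M}/H(u\mathcal{M})$ to $\mathrm{Gal}_L(T)$. In particular, one gets a sequence of continuous epimorphisms $$u\mathcal{M}\twoheadrightarrow u\mathcal{M}/H(u\mathcal{M})\xrightarrow{\ \bar f\ }\mathrm{Gal}_L(T)\twoheadrightarrow \mathrm{Gal}_{KP}(T),$$ where the first and last maps are the quotient maps.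
   Context: "Compact" does not include Hausdorff. A monster model is a model that is $\kappa$-saturated and strongly $\kappa$-homogeneous for a sufficiently large strong limit cardinal $\kappa$ (its degree of saturation); "small" means of cardinality less than the degree of saturation. $\mathfrak{C}$ is a monster model of $T$, $\bar c$ is a tuple enumerating all elements of $\mathfrak{C}$, and $\mathfrak{C}'\succ\mathfrak{C}$ is a bigger monster model whose degree of saturation is much bigger than $|\mathfrak{C}|$. Put $S_{\bar c}(\mathfrak{C})=\{\mathrm{tp}(\bar a/\mathfrak{C}) : \bar a\equiv\bar c\}$ ($\bar a$ from $\mathfrak{C}'$), a compact Hausdorff space on which $\mathrm{Aut}(\mathfrak{C})$ acts naturally. $EL$ is the Ellis semigroup of this action: the closure of $\mathrm{Aut}(\mathfrak{C})$ (each automorphism viewed as a map $S_{\bar c}(\mathfrak{C})\to S_{\bar c}(\mathfrak{C})$) in the product space $S_{\bar c}(\mathfrak{C})^{S_{\bar c}(\mathfrak{C})}$, with composition as semigroup operation; $\mathrm{Aut}(\mathfrak{C})$ is regarded as a subset of $EL$. $\mathcal{M}$ is any minimal left ideal of $EL$ and $u\in\mathcal{M}$ any idempotent; then $u\mathcal{M}$ is a group with identity $u$ (the Ellis group). For $A\subseteq EL$ and $p\in EL$, $p\circ A$ is the set of all $\eta\in EL$ for which there are nets $(\eta_i)$ in $A$ and $(g_i)$ in $\mathrm{Aut}(\mathfrak{C})$ with $\lim g_i=p$ and $\lim g_i\eta_i=\eta$. For $A\subseteq u\mathcal{M}$, $\mathrm{cl}_\tau(A)=(u\circ A)\cap u\mathcal{M}$;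 this is a closure operator which defines the $\tau$-topology on $u\mathcal{M}$ (it is compact, $T_1$, and multiplication is separately continuous). $H(u\mathcal{M})$ is the intersection of the sets $\mathrm{cl}_\tau(V)$ over all $\tau$-neighborhoods $V$ of $u$; it is a $\tau$-closed normal subgroup of $u\mathcal{M}$, and $u\mathcal{M}/H(u\mathcal{M})$ with the quotient topology is a compact Hausdorff group. Galois groups (computed in $\mathfrak{C}'$): $\mathrm{Autf}_L(\mathfrak{C}')$ is the (normal) subgroup of $\mathrm{Aut}(\mathfrak{C}')$ generated by all automorphisms fixing pointwise some small submodel; $\mathrm{Gal}_L(T)=\mathrm{Aut}(\mathfrak{C}')/\mathrm{Autf}_L(\mathfrak{C}')$. Its topology: for a small model $M$ enumerated by $\bar m$, $\mathrm{Gal}_L(T)$ carries the quotient topology from the map $S_{\bar m}(M)\to\mathrm{Gal}_L(T)$, $\mathrm{tp}(\sigma(\bar m)/M)\mapsto\sigma\,\mathrm{Autf}_L(\mathfrak{C}')$ (well defined and independent of $M$); it is a compact, not necessarily Hausdorff, topological group. $\mathrm{Gal}_0(T)$ is the closure of the identity in $\mathrm{Gal}_L(T)$, and $\mathrm{Gal}_{KP}(T)=\mathrm{Gal}_L(T)/\mathrm{Gal}_0(T)$ with the quotient topology. For $x\in EL$ let $\pi_0(x)=x(\mathrm{tp}(\bar c/\mathfrak{C}))\in S_{\bar c}(\mathfrak{C})$. The map $\hat f\colon EL\to\mathrm{Gal}_L(T)$ is $\hat f(x)=\sigma'\,\mathrm{Autf}_L(\mathfrak{C}')$, where $\sigma'\in\mathrm{Aut}(\mathfrak{C}')$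 is any automorphism with $\sigma'(\bar c)\models\pi_0(x)$ (this is well defined and a semigroup epimorphism). $f$ is the restriction of $\hat f$ to $u\mathcal{M}$; it is a group epimorphism onto $\mathrm{Gal}_L(T)$. -}

module Defs where

open import Algebra.Bundles using (Group; Monoid)
open import Algebra.Bundles.Raw using (RawGroup)
open import Algebra.Morphism.Structures using (IsGroupHomomorphism)
open import Data.Empty.Polymorphic using (⊥)
open import Data.Fin.Base using (Fin)
open import Data.List.Base using (List) renaming (map to mapᴸ)
open import Data.List.Relation.Unary.All using (All)
import Data.List.Relation.Unary.All as All
import Data.List.Relation.Unary.All.Properties as All
open import Data.Nat.Base using (ℕ) renaming (suc to 1+_)
open import Data.Product.Base using (Σ; ∃; Σ-syntax; ∃-syntax; _×_; _,_; proj₁; proj₂)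
open import Data.Sum.Base using (_⊎_; inj₁; inj₂; [_,_]; map₂)
open import Data.Unit.Polymorphic.Base using (⊤)
open import Data.Bool.Base using (Bool)
open import Data.Vec.Base using (Vec; []; _∷_; lookup; map)
open import Data.Vec.Properties using (map-cong; map-∘; map-id; lookup-map)
open import Function.Base using (_∘_)
open import Function.Bundles using (_↣_; _↔_; _⇔_; mk⇔; Func; _⟨$⟩_; module Inverse; module Equivalence)
open import Function.Construct.Composition using (_↔-∘_)
import Function.Construct.Composition as Composition
open import Function.Definitions using (Surjective; StrictlySurjective)
import Function.Properties.Equivalence as ⇔
open import Function.Properties.Inverse using (↔-refl; ↔-sym)
open import Function.Relation.Binary.Setoid.Equality using (_⇨_)
open import Level using (Level; suc; _⊔_)
open import Relation.Binary.Bundles using (Setoid)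
open import Relation.Binary.Definitions using (_Respects_)
open import Relation.Binary.PropositionalEquality using (_≡_; refl; sym; trans; cong; cong₂; subst; _≗_)
import Relation.Binary.Reasoning.Setoid as SetoidReasoning
open import Relation.Nullary using (¬_)
open import Relation.Unary using (Pred; _∈_; _⊆_; _≐_; ∁)

record Language (ℓ : Level) : Set (suc ℓ) where
  field
    Fun : ℕ → Set ℓ
    Rel : ℕ → Set ℓ

open Language

data Term {ℓ} (L : Language ℓ) (n : ℕ) : Set ℓ where
  var : Fin n → Term L n
  fun : ∀ {k} → Fun L k → Vec (Term L n) k → Term L n

-- Formulas with n free variables.  The remaining connectives and ∃ are
-- classically definable from the ones below.
data Formula {ℓ} (L : Language ℓ) : ℕ → Set ℓ where
  equal   : ∀ {n} → Term L n → Term L n → Formula L n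
  rel     : ∀ {n k} → Rel L k → Vec (Term L n) k → Formula L n
  falsum  : ∀ {n} → Formula L n
  implies : ∀ {n} → Formula L n → Formula L n → Formula L n
  forAll  : ∀ {n} → Formula L (1+ n) → Formula L n

neg : ∀ {ℓ} {L : Language ℓ} {n} → Formula L n → Formula L n
neg φ = implies φ falsum

record Structure {ℓ} (L : Language ℓ) : Set (suc ℓ) where
  field
    Carrier  : Set ℓ
    nonempty : Carrier
    funᴹ     : ∀ {k} → Fun L k → Vec Carrier k → Carrier
    relᴹ     : ∀ {k} → Rel L k → Vec Carrier k → Set ℓ

open Structure using () renaming (Carrier to ∣_∣)

module _ {ℓ} {L : Language ℓ} (M : Structure L) where
  open Structure M

  eval  : ∀ {n} → Vec Carrier n → Term L n → Carrier
  evals : ∀ {n k} → Vec Carrier n → Vec (Term L n) k → Vec Carrier k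
  eval v (var i)    = lookup v i
  eval v (fun f ts) = funᴹ f (evals v ts)
  evals v []        = []
  evals v (t ∷ ts)  = eval v t ∷ evals v ts

  Sat : ∀ {n} → Formula L n → Vec Carrier n → Set ℓ
  Sat (equal s t)   v = eval v s ≡ eval v t
  Sat (rel R ts)    v = relᴹ R (evals v ts)
  Sat falsum        v = ⊥
  Sat (implies φ ψ) v = Sat φ v → Sat ψ v
  Sat (forAll φ)    v = ∀ x → Sat φ (x ∷ v)

Theory : ∀ {ℓ} → Language ℓ → Set (suc ℓ)
Theory {ℓ} L = Pred (Formula L 0) ℓ

_⊨ₜ_ : ∀ {ℓ} {L : Language ℓ} → Structure L → Theory L → Set ℓ
M ⊨ₜ T = ∀ φ → T φ → Sat M φ []

_⊢_ : ∀ {ℓ} {L : Language ℓ} → Theory L → Formula L 0 → Set (suc ℓ)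
T ⊢ φ = ∀ M → M ⊨ₜ T → Sat M φ []

IsComplete : ∀ {ℓ} {L : Language ℓ} → Theory L → Set (suc ℓ)
IsComplete T = (∃[ M ] M ⊨ₜ T) × (∀ φ → (T ⊢ φ) ⊎ (T ⊢ neg φ))

record _≼_ {ℓ} {L : Language ℓ} (M N : Structure L) : Set ℓ where
  field
    incl       : ∣ M ∣ → ∣ N ∣
    elementary : ∀ {n} (φ : Formula L n) v → Sat M φ v ⇔ Sat N φ (map incl v)

record Automorphism {ℓ} {L : Language ℓ} (M : Structure L) : Set ℓ where
  open Structure M
  field
    bijection : Carrier ↔ Carrier
  open Inverse bijection public using (to; from; strictlyInverseˡ; strictlyInverseʳ)
  field
    to-fun : ∀ {k} (f : Fun L k) v → to (funᴹ f v) ≡ funᴹ f (map to v)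
    to-rel : ∀ {k} (R : Rel L k) v → relᴹ R v ⇔ relᴹ R (map to v)

open Automorphism using (to; from)

module _ {ℓ} {L : Language ℓ} {M : Structure L} where
  open Structure M

  module _ (σ : Automorphism M) where
    open Automorphism σ using (to-fun; to-rel; strictlyInverseˡ; strictlyInverseʳ)

    eval-to  : ∀ {n} (v : Vec Carrier n) t → eval M (map (to σ) v) t ≡ to σ (eval M v t)
    evals-to : ∀ {n k} (v : Vec Carrier n) (ts : Vec (Term L n) k) →
               evals M (map (to σ) v) ts ≡ map (to σ) (evals M v ts)
    eval-to v (var i)    = lookup-map i (to σ) v
    eval-to v (fun f ts) = trans (cong (funᴹ f) (evals-to v ts)) (sym (to-fun f _))
    evals-to v []        = refl
    evals-to v (t ∷ ts)  = cong₂ _∷_ (eval-to v t) (evals-to v ts)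

    to-injective : ∀ {x y} → to σ x ≡ to σ y → x ≡ y
    to-injective eq = trans (sym (strictlyInverseʳ _)) (trans (cong (from σ) eq) (strictlyInverseʳ _))

    Sat-to : ∀ {n} (φ : Formula L n) v → Sat M φ v ⇔ Sat M φ (map (to σ) v)
    Sat-to (equal s t) v = mk⇔
      (λ eq → trans (eval-to v s) (trans (cong (to σ) eq) (sym (eval-to v t))))
      (λ eq → to-injective (trans (sym (eval-to v s)) (trans eq (eval-to v t))))
    Sat-to (rel R ts) v = mk⇔
      (λ r → subst (relᴹ R) (sym (evals-to v ts)) (Equivalence.to (to-rel R _) r))
      (λ r → Equivalence.from (to-rel R _) (subst (relᴹ R) (evals-to v ts) r))
    Sat-to falsum v = ⇔.refl
    Sat-to (implies φ ψ) v = mk⇔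
      (λ h → Equivalence.to (Sat-to ψ v) ∘ h ∘ Equivalence.from (Sat-to φ v))
      (λ h → Equivalence.from (Sat-to ψ v) ∘ h ∘ Equivalence.to (Sat-to φ v))
    Sat-to (forAll φ) v = mk⇔
      (λ h x → subst (λ y → Sat M φ (y ∷ map (to σ) v)) (strictlyInverseˡ x)
                 (Equivalence.to (Sat-to φ (from σ x ∷ v)) (h (from σ x))))
      (λ h x → Equivalence.from (Sat-to φ (x ∷ v)) (h (to σ x)))

  idᴬ : Automorphism M
  idᴬ = record
    { bijection = ↔-refl
    ; to-fun = λ f v → sym (cong (funᴹ f) (map-id v))
    ; to-rel = λ R v → subst (λ w → relᴹ R v ⇔ relᴹ R w) (sym (map-id v)) ⇔.refl
    }

  _∘ᴬ_ : Automorphism M → Automorphism M → Automorphism M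
  σ ∘ᴬ τ = record
    { bijection = S.bijection ↔-∘ T.bijection
    ; to-fun = λ f v → trans (cong S.to (T.to-fun f v))
        (trans (S.to-fun f _) (sym (cong (funᴹ f) (map-∘ S.to T.to v))))
    ; to-rel = λ R v → subst (λ w → relᴹ R v ⇔ relᴹ R w) (sym (map-∘ S.to T.to v))
        (⇔.trans (T.to-rel R v) (S.to-rel R _))
    } where module S = Automorphism σ
            module T = Automorphism τ

  map-to-from : ∀ (σ : Automorphism M) {n} (v : Vec Carrier n) → map (to σ) (map (from σ) v) ≡ v
  map-to-from σ v = trans (sym (map-∘ (to σ) (from σ) v))
    (trans (map-cong (Automorphism.strictlyInverseˡ σ) v) (map-id v))

  invᴬ : Automorphism M → Automorphism M
  invᴬ σ = record
    { bijection = ↔-sym S.bijection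
    ; to-fun = λ f v → to-injective σ (trans (S.strictlyInverseˡ _)
        (sym (trans (S.to-fun f _) (cong (funᴹ f) (map-to-from σ v)))))
    ; to-rel = λ R v → ⇔.sym (subst (λ w → relᴹ R (map S.from v) ⇔ relᴹ R w)
        (map-to-from σ v) (S.to-rel R _))
    } where module S = Automorphism σ

Aut : ∀ {ℓ} {L : Language ℓ} (M : Structure L) → Group ℓ ℓ
Aut M = record
  { Carrier = Automorphism M
  ; _≈_ = λ σ τ → to σ ≗ to τ
  ; _∙_ = _∘ᴬ_
  ; ε = idᴬ
  ; _⁻¹ = invᴬ
  ; isGroup = record
    { isMonoid = record
      { isSemigroup = record
        { isMagma = record
          { isEquivalence = record
            { refl = λ _ → refl
            ; sym = λ p x → sym (p x)
            ; trans = λ p q x → trans (p x) (q x) }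
          ; ∙-cong = λ {σ} p q x → trans (cong (to σ) (q x)) (p _) }
        ; assoc = λ _ _ _ _ → refl }
      ; identity = (λ _ _ → refl) , (λ _ _ → refl) }
    ; inverse = (λ σ x → Automorphism.strictlyInverseʳ σ x)
              , (λ σ x → Automorphism.strictlyInverseˡ σ x)
    ; ⁻¹-cong = λ {σ} {τ} p x → to-injective σ
        (trans (Automorphism.strictlyInverseˡ σ x)
          (trans (sym (Automorphism.strictlyInverseˡ τ x)) (sym (p _))))
    }
  }

-- A cardinal is represented by any type of that cardinality.
_<ᶜ_ : ∀ {ℓ} → Set ℓ → Set ℓ → Set ℓ
A <ᶜ B = (A ↣ B) × ¬ (B ↣ A)

IsStrongLimit : ∀ {ℓ} → Set ℓ → Set (suc ℓ)
IsStrongLimit {ℓ} κ = ∀ (A : Set ℓ) → A <ᶜ κ → (A → Bool) <ᶜ κ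

-- Formulas whose free variables are filled with variables from X and
-- parameters from A.
ParamFormula : ∀ {ℓ} → Language ℓ → (X A : Set ℓ) → Set ℓ
ParamFormula L X A = Σ[ n ∈ ℕ ] Formula L n × Vec (X ⊎ A) n

module _ {ℓ} {L : Language ℓ} (N : Structure L) where

  SatParam : ∀ {X A : Set ℓ} → (X → ∣ N ∣) → (A → ∣ N ∣) → ParamFormula L X A → Set ℓ
  SatParam x a (_ , φ , v) = Sat N φ (map [ x , a ] v)

  -- tp(a) = tp(b)
  SameType : ∀ {I : Set ℓ} → (a b : I → ∣ N ∣) → Set ℓ
  SameType {I} a b = ∀ {n} (φ : Formula L n) (v : Vec I n) → Sat N φ (map a v) ⇔ Sat N φ (map b v)

  IsSaturated : Set ℓ → Set (suc ℓ)
  IsSaturated κ = ∀ (A : Set ℓ) → A <ᶜ κ → (a : A → ∣ N ∣) (Γ : Pred (ParamFormula L ⊤ A) ℓ) →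
    (∀ θs → All Γ θs → ∃[ c ] All (SatParam (λ _ → c) a) θs) →
    ∃[ c ] (Γ ⊆ SatParam (λ _ → c) a)

  IsStronglyHomogeneous : Set ℓ → Set (suc ℓ)
  IsStronglyHomogeneous κ = ∀ (A : Set ℓ) → A <ᶜ κ → (a b : A → ∣ N ∣) → SameType a b →
    Σ[ σ ∈ Automorphism N ] (∀ i → to σ (a i) ≡ b i)

  -- The number of formulas is |T|, so `large` says |T| < κ; in
  -- particular κ is uncountable.
  record IsMonster (κ : Set ℓ) : Set (suc ℓ) where
    field
      strongLimit         : IsStrongLimit κ
      large               : (Σ[ n ∈ ℕ ] Formula L n) <ᶜ κ
      saturated           : IsSaturated κ
      stronglyHomogeneous : IsStronglyHomogeneous κ

record MonsterPair {ℓ} {L : Language ℓ} (T : Theory L) : Set (suc ℓ) where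
  field
    κ κ′       : Set ℓ
    ℭ ℭ′       : Structure L
    ℭ-models   : ℭ ⊨ₜ T
    ℭ-monster  : IsMonster ℭ κ
    ℭ′-monster : IsMonster ℭ′ κ′
    ℭ≼ℭ′       : ℭ ≼ ℭ′
    ℭ-small    : ∣ ℭ ∣ <ᶜ κ′

record Enumeration {ℓ} {L : Language ℓ} (M : Structure L) : Set (suc ℓ) where
  field
    Index      : Set ℓ
    tuple      : Index → ∣ M ∣
    surjective : StrictlySurjective _≡_ tuple

record SmallSubmodel {ℓ} {L : Language ℓ} (N : Structure L) (κ : Set ℓ) : Set (suc ℓ) where
  field
    model : Structure L
    model≼ : model ≼ N
    small : ∣ model ∣ <ᶜ κ
  open _≼_ model≼ public

-- A space presented by a subbasis, x ∋ j meaning that x lies in the j-th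
-- subbasic open set.
record Space (ℓ : Level) : Set (suc ℓ) where
  field
    setoid : Setoid ℓ ℓ
    Sub    : Set ℓ
    _∋_    : Setoid.Carrier setoid → Sub → Set ℓ
  open Setoid setoid public

  _∋*_ : Carrier → List Sub → Set ℓ
  x ∋* js = All (x ∋_) js

  IsOpen : Pred Carrier ℓ → Set ℓ
  IsOpen U = ∀ {x} → x ∈ U → ∃[ js ] x ∋* js × (∀ {y} → y ∋* js → y ∈ U)

  closure : Pred Carrier ℓ → Pred Carrier ℓ
  closure A x = ∀ js → x ∋* js → ∃[ y ] y ∈ A × y ∋* js

record DirectedSet (ℓ : Level) : Set (suc ℓ) where
  field
    Carrier   : Set ℓ
    _≤_       : Carrier → Carrier → Set ℓ
    ≤-refl    : ∀ {i} → i ≤ i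
    ≤-trans   : ∀ {i j k} → i ≤ j → j ≤ k → i ≤ k
    inhabited : Carrier
    directed  : ∀ i j → ∃[ k ] i ≤ k × j ≤ k

module _ {ℓ} (X : Space ℓ) (D : DirectedSet ℓ) where
  open Space X
  open DirectedSet D using (_≤_) renaming (Carrier to I)

  Converges : (I → Carrier) → Carrier → Set ℓ
  Converges xs x = ∀ js → x ∋* js → ∃[ i₀ ] (∀ i → i₀ ≤ i → xs i ∋* js)

-- The product space X^X.  As points of X are identified up to ≈, its
-- points are the ≈-preserving maps.
selfMaps : ∀ {ℓ} → Space ℓ → Space ℓ
selfMaps X = record
  { setoid = setoid ⇨ setoid
  ; Sub    = Carrier × Sub
  ; _∋_    = λ { f (x , j) → (f ⟨$⟩ x) ∋ j }
  } where open Space X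

-- Open sets are predicates with values in Set ℓ, which under excluded
-- middle represent all subsets of the carrier.  No laws are demanded, so
-- that a quotient can be formed before the subset divided out is proved
-- to be a normal subgroup.
record TopGroup (ℓ e o : Level) : Set (suc (ℓ ⊔ e ⊔ o)) where
  field
    rawGroup : RawGroup ℓ e
  open RawGroup rawGroup public
  field
    IsOpen : Pred Carrier ℓ → Set o

module _ {ℓ e e′ o o′} (G : TopGroup ℓ e o) (H : TopGroup ℓ e′ o′) where
  private
    module G = TopGroup G
    module H = TopGroup H

  IsContinuous : (G.Carrier → H.Carrier) → Set (suc ℓ ⊔ o ⊔ o′)
  IsContinuous f = ∀ U → H.IsOpen U → G.IsOpen (U ∘ f)

  record IsContinuousEpimorphism (f : G.Carrier → H.Carrier) : Set (suc ℓ ⊔ e ⊔ e′ ⊔ o ⊔ o′) where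
    field
      homomorphism : IsGroupHomomorphism G.rawGroup H.rawGroup f
      surjective   : Surjective G._≈_ H._≈_ f
      continuous   : IsContinuous f

module _ {ℓ e} (G : RawGroup ℓ e) where
  open RawGroup G

  LeftCoset : ∀ {n} → Carrier → Pred Carrier n → Pred Carrier (ℓ ⊔ e ⊔ n)
  LeftCoset x N y = ∃[ h ] h ∈ N × y ≈ x ∙ h

  -- Elements of G/N are represented by elements x of G standing for xN,
  -- and the operations are (xN)(yN) = xyN and (xN)⁻¹ = x⁻¹N.
  quotientGroup : ∀ {n} → Pred Carrier n → RawGroup ℓ (ℓ ⊔ e ⊔ n)
  quotientGroup N = record
    { Carrier = Carrier
    ; _≈_ = λ x y → LeftCoset x N ≐ LeftCoset y N
    ; _∙_ = _∙_
    ; ε = ε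
    ; _⁻¹ = _⁻¹
    }

_/_ : ∀ {ℓ e o n} (G : TopGroup ℓ e o) → Pred (TopGroup.Carrier G) n →
      TopGroup ℓ (ℓ ⊔ e ⊔ n) (ℓ ⊔ e ⊔ o ⊔ n)
G / N = record
  { rawGroup = Q
  ; IsOpen = λ U → U Respects RawGroup._≈_ Q × IsOpen U
  } where open TopGroup G
          Q = quotientGroup rawGroup N

groupFromLeftInverses : ∀ {c e} (M : Monoid c e) → let open Monoid M in
                        (∀ x → ∃[ y ] y ∙ x ≈ ε) → Group c e
groupFromLeftInverses M leftInverse = record
  { isGroup = record
    { isMonoid = isMonoid
    ; inverse = invˡ , invʳ
    ; ⁻¹-cong = λ {x} {y} x≈y → begin
        inv x                ≈⟨ identityʳ (inv x) ⟨
        inv x ∙ ε            ≈⟨ ∙-congˡ (invʳ y) ⟨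
        inv x ∙ (y ∙ inv y)  ≈⟨ assoc (inv x) y (inv y) ⟨
        (inv x ∙ y) ∙ inv y  ≈⟨ ∙-congʳ (∙-congˡ x≈y) ⟨
        (inv x ∙ x) ∙ inv y  ≈⟨ ∙-congʳ (invˡ x) ⟩
        ε ∙ inv y            ≈⟨ identityˡ (inv y) ⟩
        inv y                ∎
    }
  }
  where
  open Monoid M
  open SetoidReasoning setoid

  inv : Carrier → Carrier
  inv x = proj₁ (leftInverse x)

  invˡ : ∀ x → inv x ∙ x ≈ ε
  invˡ x = proj₂ (leftInverse x)

  invʳ : ∀ x → x ∙ inv x ≈ ε
  invʳ x = begin
    x ∙ y                ≈⟨ identityˡ (x ∙ y) ⟨
    ε ∙ (x ∙ y)          ≈⟨ ∙-congʳ (invˡ y) ⟨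
    (inv y ∙ y) ∙ (x ∙ y) ≈⟨ assoc (inv y) y (x ∙ y) ⟩
    inv y ∙ (y ∙ (x ∙ y)) ≈⟨ ∙-congˡ (assoc y x y) ⟨
    inv y ∙ ((y ∙ x) ∙ y) ≈⟨ ∙-congˡ (∙-congʳ (invˡ x)) ⟩
    inv y ∙ (ε ∙ y)      ≈⟨ ∙-congˡ (identityˡ y) ⟩
    inv y ∙ y            ≈⟨ invˡ y ⟩
    ε                    ∎
    where y = inv x

data Generated {ℓ n} (G : Group ℓ ℓ) (S : Pred (Group.Carrier G) n) :
               Pred (Group.Carrier G) (ℓ ⊔ n) where
  generator : ∀ {x} → x ∈ S → Generated G S x
  identity  : Generated G S (Group.ε G)
  product   : ∀ {x y} → Generated G S x → Generated G S y → Generated G S (Group._∙_ G x y)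
  inverse   : ∀ {x} → Generated G S x → Generated G S (Group._⁻¹ G x)
  resp-≈    : ∀ {x y} → Group._≈_ G x y → Generated G S x → Generated G S y

module _ {ℓ} {L : Language ℓ} {N : Structure L} {κ : Set ℓ} where

  module _ (M : SmallSubmodel N κ) (m̄ : Enumeration (SmallSubmodel.model M)) where
    open SmallSubmodel M
    open Enumeration m̄ renaming (tuple to m)

    -- A tuple ā ≡ m̄, standing for tp(ā/M).
    record Realization : Set ℓ where
      field
        tuple     : Index → ∣ N ∣
        conjugate : SameType N tuple (incl ∘ m)

    -- S_m̄(M).
    typeSpace : Space ℓ
    typeSpace = record
      { setoid = record
        { Carrier = Realization
        ; _≈_ = λ a b → ∀ θ → a ∋ θ ⇔ b ∋ θ
        ; isEquivalence = record
          { refl = λ _ → ⇔.refl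
          ; sym = λ p θ → ⇔.sym (p θ)
          ; trans = λ p q θ → ⇔.trans (p θ) (q θ)
          }
        }
      ; Sub = ParamFormula L Index ∣ model ∣
      ; _∋_ = _∋_
      } where
        _∋_ : Realization → ParamFormula L Index ∣ model ∣ → Set ℓ
        a ∋ θ = SatParam N (Realization.tuple a) incl θ

    -- tp(m̄/M)
    basePoint : Realization
    basePoint = record { tuple = incl ∘ m ; conjugate = λ _ _ → ⇔.refl }

    module _ (hom : IsStronglyHomogeneous N κ) where

      realizingAutomorphism : (a : Realization) →
        Σ[ σ ∈ Automorphism N ] (∀ i → to σ (incl (m i)) ≡ Realization.tuple a i)
      realizingAutomorphism a = proj₁ h , λ i → trans (proj₂ h (m i)) (back i)
        where
        open Realization a
        section : ∣ model ∣ → Index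
        section x = proj₁ (surjective x)

        sec : ∀ {k} (v : Vec ∣ model ∣ k) → map (incl ∘ m) (map section v) ≡ map incl v
        sec v = trans (sym (map-∘ (incl ∘ m) section v))
                      (map-cong (λ x → cong incl (proj₂ (surjective x))) v)

        h = hom ∣ model ∣ small incl (tuple ∘ section) λ φ v →
          subst (λ w → Sat N φ w ⇔ Sat N φ (map (tuple ∘ section) v)) (sec v)
            (subst (λ w → Sat N φ (map (incl ∘ m) (map section v)) ⇔ Sat N φ w)
              (sym (map-∘ tuple section v)) (⇔.sym (conjugate φ (map section v))))

        back : ∀ i → tuple (section (m i)) ≡ tuple i
        back i = Equivalence.from
          (conjugate (equal (var Fin.zero) (var (Fin.suc Fin.zero))) (section (m i) ∷ i ∷ []))
          (cong incl (proj₂ (surjective (m i))))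

      -- tp(σ(m̄)/M) ↦ σ.  Any other choice of σ represents the same
      -- element of Gal_L(T).
      typeToAut : Realization → Automorphism N
      typeToAut a = proj₁ (realizingAutomorphism a)

module _ {ℓ} {L : Language ℓ} (N : Structure L) (κ : Set ℓ) where

  FixesSmallSubmodel : Pred (Automorphism N) (suc ℓ)
  FixesSmallSubmodel σ = Σ[ M ∈ SmallSubmodel N κ ] let open SmallSubmodel M in
    ∀ x → to σ (incl x) ≡ incl x

  Autf-L : Pred (Automorphism N) (suc ℓ)
  Autf-L = Generated (Aut N) FixesSmallSubmodel

-- Gal_L(T) computed in N, with the topology induced from S_m̄(M).
Gal-L : ∀ {ℓ} {L : Language ℓ} {N : Structure L} {κ : Set ℓ} → IsStronglyHomogeneous N κ →
        (M : SmallSubmodel N κ) → Enumeration (SmallSubmodel.model M) → TopGroup ℓ (suc ℓ) (suc ℓ)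
Gal-L {N = N} {κ} hom M m̄ = record
  { rawGroup = Q
  ; IsOpen = λ U → U Respects RawGroup._≈_ Q ×
                   Space.IsOpen (typeSpace M m̄) (U ∘ typeToAut M m̄ hom)
  } where Q = quotientGroup (Group.rawGroup (Aut N)) (Autf-L N κ)

closureOfIdentity : ∀ {ℓ e o} (G : TopGroup ℓ e o) → Pred (TopGroup.Carrier G) (suc ℓ ⊔ o)
closureOfIdentity G x = ∀ U → IsOpen U → x ∈ U → ε ∈ U
  where open TopGroup G

Gal-KP : ∀ {ℓ} {L : Language ℓ} {N : Structure L} {κ : Set ℓ} → IsStronglyHomogeneous N κ →
         (M : SmallSubmodel N κ) → Enumeration (SmallSubmodel.model M) → TopGroup ℓ (suc ℓ) (suc ℓ)
Gal-KP hom M m̄ = Gal-L hom M m̄ / closureOfIdentity (Gal-L hom M m̄)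

module Ellis {ℓ} {L : Language ℓ} {T : Theory L} (P : MonsterPair T)
             (c̄ : Enumeration (MonsterPair.ℭ P)) where
  open MonsterPair P
  open _≼_ ℭ≼ℭ′ renaming (incl to ι)
  open IsMonster ℭ′-monster using (stronglyHomogeneous)
  open Enumeration c̄ using (Index)

  ℭ-submodel : SmallSubmodel ℭ′ κ′
  ℭ-submodel = record { model = ℭ ; model≼ = ℭ≼ℭ′ ; small = ℭ-small }

  S : Space ℓ
  S = typeSpace ℭ-submodel c̄

  open Space S using (_∋_) renaming (Carrier to Point; _≈_ to _≈ₛ_)

  extension : (g : Automorphism ℭ) → Σ[ g′ ∈ Automorphism ℭ′ ] (∀ x → to g′ (ι x) ≡ ι (to g x))
  extension g = stronglyHomogeneous ∣ ℭ ∣ ℭ-small ι (ι ∘ to g) λ φ v →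
    ⇔.trans (⇔.sym (elementary φ v))
      (⇔.trans (Sat-to g φ v)
        (subst (λ w → Sat ℭ φ (map (to g) v) ⇔ Sat ℭ′ φ w) (sym (map-∘ ι (to g) v))
          (elementary φ (map (to g) v))))

  -- g · tp(ā/ℭ) = tp(g′(ā)/ℭ) for any extension g′ ∈ Aut(ℭ′) of g.
  act : Automorphism ℭ → Point → Point
  act g a = record
    { tuple = to g′ ∘ tuple
    ; conjugate = λ φ v → ⇔.trans
        (subst (λ w → Sat ℭ′ φ w ⇔ Sat ℭ′ φ (map tuple v)) (sym (map-∘ (to g′) tuple v))
          (⇔.sym (Sat-to g′ φ (map tuple v))))
        (conjugate φ v)
    } where open Realization a
            g′ = proj₁ (extension g)

  pullback : Automorphism ℭ → ParamFormula L Index ∣ ℭ ∣ → ParamFormula L Index ∣ ℭ ∣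
  pullback g (n , φ , v) = n , φ , map (map₂ (from g)) v

  -- φ(x̄,b) ∈ g·p iff φ(x̄,g⁻¹b) ∈ p
  act-∋ : ∀ g a θ → act g a ∋ θ ⇔ a ∋ pullback g θ
  act-∋ g a (n , φ , v) =
    subst (λ w → Sat ℭ′ φ w ⇔ Sat ℭ′ φ (map [ tuple , ι ] (map (map₂ (from g)) v))) eq
      (⇔.sym (Sat-to g′ φ _))
    where
    open Realization a
    g′ = proj₁ (extension g)

    pointwise : ∀ x → to g′ ([ tuple , ι ] (map₂ (from g) x)) ≡ [ to g′ ∘ tuple , ι ] x
    pointwise (inj₁ i) = refl
    pointwise (inj₂ b) = trans (proj₂ (extension g) (from g b))
                               (cong ι (Automorphism.strictlyInverseˡ g b))

    eq : map (to g′) (map [ tuple , ι ] (map (map₂ (from g)) v)) ≡ map [ to g′ ∘ tuple , ι ] v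
    eq = trans (cong (map (to g′)) (sym (map-∘ _ _ v)))
           (trans (sym (map-∘ _ _ v)) (map-cong pointwise v))

  actMap : Automorphism ℭ → Func (Space.setoid S) (Space.setoid S)
  actMap g = record
    { to = act g
    ; cong = λ {a} {b} a≈b θ →
        ⇔.trans (act-∋ g a θ) (⇔.trans (a≈b (pullback g θ)) (⇔.sym (act-∋ g b θ)))
    }

  act-∘ : ∀ g h a → act g (act h a) ≈ₛ act (g ∘ᴬ h) a
  act-∘ g h a θ@(n , φ , v) = ⇔.trans (act-∋ g (act h a) θ) (⇔.trans (act-∋ h a (pullback g θ))
    (⇔.sym (subst (λ w → act (g ∘ᴬ h) a ∋ θ ⇔ a ∋ (n , φ , w)) pullback-∘ (act-∋ (g ∘ᴬ h) a θ))))
    where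
    pointwise : ∀ (x : Index ⊎ ∣ ℭ ∣) → map₂ (from (g ∘ᴬ h)) x ≡ map₂ (from h) (map₂ (from g) x)
    pointwise (inj₁ _) = refl
    pointwise (inj₂ _) = refl

    pullback-∘ : map (map₂ (from (g ∘ᴬ h))) v ≡ map (map₂ (from h)) (map (map₂ (from g)) v)
    pullback-∘ = trans (map-cong pointwise v) (map-∘ _ _ v)

  private
    module SS = Space (selfMaps S)

  IsAut : Pred SS.Carrier ℓ
  IsAut f = ∃[ g ] f SS.≈ actMap g

  record EL : Set ℓ where
    constructor mkEL
    field
      fn         : SS.Carrier
      in-closure : fn ∈ SS.closure IsAut
  open EL public

  infix 4 _≈_
  infixr 9 _∙_

  -- A record only so that Agda can infer x and y.
  record _≈_ (x y : EL) : Set ℓ where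
    constructor mk≈
    field
      pointwise : fn x SS.≈ fn y
  open _≈_ public

  ELSpace : Space ℓ
  ELSpace = record
    { setoid = record
      { Carrier = EL
      ; _≈_ = _≈_
      ; isEquivalence = record
        { refl = λ {x} → mk≈ (SS.refl {fn x})
        ; sym = λ {x} {y} p → mk≈ (SS.sym {fn x} {fn y} (pointwise p))
        ; trans = λ {x} {y} {z} p q → mk≈ (SS.trans {fn x} {fn y} {fn z} (pointwise p) (pointwise q))
        }
      }
    ; Sub = SS.Sub
    ; _∋_ = λ x → fn x SS.∋_
    }

  aut : Automorphism ℭ → EL
  aut g = mkEL (actMap g) λ js p → actMap g , (g , SS.refl {actMap g}) , p

  approximate : ∀ (x : EL) {js} → fn x SS.∋* js → ∃[ g ] actMap g SS.∋* js
  approximate x {js} x∋js = let (_ , (g , f≈g) , f∋js) = in-closure x js x∋js in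
    g , All.map (λ {j} → Equivalence.to (f≈g (proj₁ j) (proj₂ j))) f∋js

  abstract
    ∘-in-closure : ∀ (x y : EL) → Composition.function (fn y) (fn x) ∈ SS.closure IsAut
    ∘-in-closure x y js xy∋js =
      actMap (g ∘ᴬ h) , (g ∘ᴬ h , SS.refl {actMap (g ∘ᴬ h)}) , All.map (λ {j} → gh∋ j) (All.map⁻ (proj₂ hy))
      where
      shift : SS.Sub → SS.Sub
      shift (a , θ) = fn y ⟨$⟩ a , θ

      move : Automorphism ℭ → SS.Sub → SS.Sub
      move g (a , θ) = a , pullback g θ

      gx : ∃[ g ] actMap g SS.∋* mapᴸ shift js
      gx = approximate x (All.map⁺ xy∋js)

      g : Automorphism ℭ
      g = proj₁ gx

      y∋ : ∀ j → actMap g SS.∋ shift j → fn y SS.∋ move g j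
      y∋ (a , θ) = Equivalence.to (act-∋ g (fn y ⟨$⟩ a) θ)

      hy : ∃[ h ] actMap h SS.∋* mapᴸ (move g) js
      hy = approximate y (All.map⁺ (All.map (λ {j} → y∋ j) (All.map⁻ (proj₂ gx))))

      h : Automorphism ℭ
      h = proj₁ hy

      gh∋ : ∀ j → actMap h SS.∋ move g j → actMap (g ∘ᴬ h) SS.∋ j
      gh∋ (a , θ) m = Equivalence.to (act-∘ g h a θ) (Equivalence.from (act-∋ g (act h a) θ) m)

  _∙_ : EL → EL → EL
  x ∙ y = mkEL (Composition.function (fn y) (fn x)) (∘-in-closure x y)

  ∙-cong : ∀ {x x′ y y′} → x ≈ x′ → y ≈ y′ → x ∙ y ≈ x′ ∙ y′
  ∙-cong {x} {x′} {y} {y′} p q = mk≈ λ a θ →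
    ⇔.trans (Func.cong (fn x) (pointwise q a) θ) (pointwise p (fn y′ ⟨$⟩ a) θ)

  ∙-assoc : ∀ x y z → (x ∙ y) ∙ z ≈ x ∙ (y ∙ z)
  ∙-assoc x y z = mk≈ λ _ _ → ⇔.refl

  -- p ∘ A
  circle : EL → Pred EL ℓ → Pred EL (suc ℓ)
  circle p A η = Σ[ D ∈ DirectedSet ℓ ] let open DirectedSet D renaming (Carrier to I) in
    Σ[ ηs ∈ (I → EL) ] Σ[ gs ∈ (I → Automorphism ℭ) ]
      (∀ i → ηs i ∈ A) ×
      Converges ELSpace D (λ i → aut (gs i)) p ×
      Converges ELSpace D (λ i → aut (gs i) ∙ ηs i) η

  -- x ↦ σ′ with σ′(c̄) ⊨ x(tp(c̄/ℭ))
  f̂ : EL → Automorphism ℭ′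
  f̂ x = typeToAut ℭ-submodel c̄ stronglyHomogeneous (fn x ⟨$⟩ basePoint ℭ-submodel c̄)

  record IsLeftIdeal (A : Pred EL ℓ) : Set ℓ where
    field
      respects : A Respects _≈_
      nonempty : ∃ A
      absorbs  : ∀ x {y} → y ∈ A → x ∙ y ∈ A

  record IsMinimalLeftIdeal (A : Pred EL ℓ) : Set (suc ℓ) where
    field
      isLeftIdeal : IsLeftIdeal A
      minimal     : ∀ B → IsLeftIdeal B → B ⊆ A → A ⊆ B
    open IsLeftIdeal isLeftIdeal public

  module EllisGroup {𝓜 : Pred EL ℓ} (𝓜-minimal : IsMinimalLeftIdeal 𝓜)
                    {u : EL} (u∈𝓜 : u ∈ 𝓜) (u-idempotent : u ∙ u ≈ u) where
    open IsMinimalLeftIdeal 𝓜-minimal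
    open Space ELSpace using (setoid) renaming (refl to ≈-refl; sym to ≈-sym; trans to ≈-trans)
    open SetoidReasoning setoid

    InEllisGroup : Pred EL ℓ
    InEllisGroup x = ∃[ m ] m ∈ 𝓜 × x ≈ u ∙ m

    InEllisGroup⊆𝓜 : InEllisGroup ⊆ 𝓜
    InEllisGroup⊆𝓜 (_ , m∈𝓜 , x≈um) = respects (≈-sym x≈um) (absorbs u m∈𝓜)

    u-identityˡ : ∀ {x} → InEllisGroup x → u ∙ x ≈ x
    u-identityˡ {x} (m , _ , x≈um) = begin
      u ∙ x       ≈⟨ ∙-cong ≈-refl x≈um ⟩
      u ∙ (u ∙ m) ≈⟨ ∙-assoc u u m ⟨
      (u ∙ u) ∙ m ≈⟨ ∙-cong u-idempotent ≈-refl ⟩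
      u ∙ m       ≈⟨ x≈um ⟨
      x           ∎

    principal : EL → Pred EL ℓ
    principal p x = ∃[ m ] m ∈ 𝓜 × x ≈ m ∙ p

    𝓜⊆principal : ∀ {p} → p ∈ 𝓜 → 𝓜 ⊆ principal p
    𝓜⊆principal {p} p∈𝓜 = minimal (principal p)
      record
        { respects = λ {x} {y} x≈y (m , m∈𝓜 , x≈mp) → m , m∈𝓜 , ≈-trans (≈-sym x≈y) x≈mp
        ; nonempty = p ∙ p , p , p∈𝓜 , ≈-refl {p ∙ p}
        ; absorbs = λ z {x} (m , m∈𝓜 , x≈mp) →
            z ∙ m , absorbs z m∈𝓜 , ≈-trans (∙-cong ≈-refl x≈mp) (≈-sym (∙-assoc z m p))
        }
      λ (m , _ , x≈mp) → respects (≈-sym x≈mp) (absorbs m p∈𝓜)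

    u-identityʳ : ∀ {x} → x ∈ 𝓜 → x ∙ u ≈ x
    u-identityʳ {x} x∈𝓜 = let (m , _ , x≈mu) = 𝓜⊆principal u∈𝓜 x∈𝓜 in begin
      x ∙ u       ≈⟨ ∙-cong x≈mu ≈-refl ⟩
      (m ∙ u) ∙ u ≈⟨ ∙-assoc m u u ⟩
      m ∙ (u ∙ u) ≈⟨ ∙-cong ≈-refl u-idempotent ⟩
      m ∙ u       ≈⟨ x≈mu ⟨
      x           ∎

    ellisMonoid : Monoid ℓ ℓ
    ellisMonoid = record
      { Carrier = Σ EL InEllisGroup
      ; _≈_ = λ p q → proj₁ p ≈ proj₁ q
      ; _∙_ = λ { (x , m , m∈𝓜 , x≈um) (y , y∈u𝓜) →
          x ∙ y , m ∙ y , absorbs m (InEllisGroup⊆𝓜 y∈u𝓜) ,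
          ≈-trans (∙-cong x≈um ≈-refl) (∙-assoc u m y) }
      ; ε = u , u , u∈𝓜 , ≈-sym u-idempotent
      ; isMonoid = record
        { isSemigroup = record
          { isMagma = record
            { isEquivalence = record { refl = ≈-refl ; sym = ≈-sym ; trans = ≈-trans }
            ; ∙-cong = ∙-cong
            }
          ; assoc = λ p q r → ∙-assoc (proj₁ p) (proj₁ q) (proj₁ r)
          }
        ; identity = (λ p → u-identityˡ (proj₂ p)) , λ p → u-identityʳ (InEllisGroup⊆𝓜 (proj₂ p))
        }
      }

    leftInverse : ∀ p → let open Monoid ellisMonoid renaming (_∙_ to _·_; _≈_ to _≋_) in
                  ∃[ q ] q · p ≋ ε
    leftInverse (x , x∈u𝓜) = let (m , m∈𝓜 , u≈mx) = 𝓜⊆principal (InEllisGroup⊆𝓜 x∈u𝓜) u∈𝓜 in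
      (u ∙ m , m , m∈𝓜 , ≈-refl) , (begin
        (u ∙ m) ∙ x ≈⟨ ∙-assoc u m x ⟩
        u ∙ (m ∙ x) ≈⟨ ∙-cong ≈-refl u≈mx ⟨
        u ∙ u       ≈⟨ u-idempotent ⟩
        u           ∎)

    ellisGroup : Group ℓ ℓ
    ellisGroup = groupFromLeftInverses ellisMonoid leftInverse

    open Group ellisGroup using () renaming (Carrier to u𝓜)

    -- (u ∘ A) ∩ u𝓜
    cl-τ : Pred u𝓜 ℓ → Pred u𝓜 (suc ℓ)
    cl-τ A p = circle u (λ x → ∃[ a ] a ∈ A × x ≈ proj₁ a) (proj₁ p)

    IsClosed-τ : Pred u𝓜 ℓ → Set (suc ℓ)
    IsClosed-τ A = cl-τ A ⊆ A

    IsOpen-τ : Pred u𝓜 ℓ → Set (suc ℓ)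
    IsOpen-τ U = IsClosed-τ (∁ U)

    Neighbourhood-τ : u𝓜 → Pred u𝓜 ℓ → Set (suc ℓ)
    Neighbourhood-τ p V = ∃[ U ] IsOpen-τ U × p ∈ U × U ⊆ V

    u𝓜-τ : TopGroup ℓ ℓ (suc ℓ)
    u𝓜-τ = record { rawGroup = Group.rawGroup ellisGroup ; IsOpen = IsOpen-τ }

    H : Pred u𝓜 (suc ℓ)
    H p = ∀ V → Neighbourhood-τ (Group.ε ellisGroup) V → p ∈ cl-τ V

    -- Also the underlying function of pH(u𝓜) ↦ f(p): u𝓜 / H has the
    -- carrier of u𝓜 with a coarser equality.
    f : u𝓜 → Automorphism ℭ′
    f p = f̂ (proj₁ p)

{-# OPTIONS --safe #-}

-- Everything is read off from one compactness principle, limitPair: pairs of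
-- automorphisms (ρ, τ) of ℭ′ that satisfy every finite part of given types of
-- ρ(c̄) and τ(c̄) over ℭ, and of a joint type of ρ(k̄) and τ(k̄), have a limit
-- which is again a pair of automorphisms.
--
-- If p ∈ cl_τ(A), then nets gᵢ → u and ηᵢ ∈ A with gᵢηᵢ → p give the pairs
-- (gᵢ′σᵢ, gᵢ′), where gᵢ′ extends gᵢ and σᵢ represents f(ηᵢ).  Their limit (ρ, τ)
-- has ρ(c̄) ⊨ p(tp(c̄/ℭ)) and τ(c̄) ⊨ u(tp(c̄/ℭ)), so that ρ represents f(p) and τ
-- represents f(u) = 1, while every condition that holds of all (σᵢ(k̄), k̄) holds
-- of (ρ(k̄), τ(k̄)).  With k̄ ⊇ m̄ and the condition "σᵢ(m̄) lies in the given
-- closed set" this shows that f is continuous.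
--
-- Since Gal_L(T) need not be Hausdorff, continuity does not give H(u𝓜) ≤ ker f.
-- Call ψ(x̄, ȳ) thick if it holds whenever x̄ and ȳ have the same type over ℭ.  The
-- set B of those p for which ¬ψ is consistent with p(tp(c̄/ℭ))(x̄) and
-- u(tp(c̄/ℭ))(ȳ) is τ-closed and does not contain u, so its complement is a
-- neighbourhood of u, on which ψ(σ(c̄), c̄) holds for σ representing f.  Hence every
-- p ∈ H(u𝓜) yields a limit pair (ρ, τ) satisfying all thick formulas at once, and
-- such a pair has the same image in Gal_L(T).
--
-- Surjectivity holds because Aut(ℭ)·tp(c̄/ℭ) is dense in the type space and EL is
-- compact.  Excluded middle yields Zorn's lemma by way of the Bourbaki–Witt
-- theorem, and Zorn's lemma yields the saturation for tuples that is used
-- throughout.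
module Submission where

open import Defs
open import Algebra.Bundles using (Group)
open import Algebra.Bundles.Raw using (RawGroup)
import Algebra.Properties.Group as GroupProperties
open import Axiom.ExcludedMiddle using (ExcludedMiddle)
open import Axiom.Extensionality.Propositional using (Extensionality)
open import Data.Bool.Base using (Bool; true; false; not)
open import Data.Bool.Properties using (not-injective)
open import Data.Empty.Polymorphic using (⊥; ⊥-elim)
open import Data.Fin.Base using (Fin; zero; suc; toℕ; _↑ˡ_; _↑ʳ_) renaming (lift to liftᶠ)
open import Data.Fin.Properties using (toℕ-injective)
open import Data.List.Base using (List; []; _∷_; _++_; filter) renaming (map to mapᴸ)
open import Data.List.Membership.Propositional using () renaming (_∈_ to _∈ᴸ_)
open import Data.List.Membership.Propositional.Properties using (∈-filter⁺; ∈-filter⁻)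
open import Data.List.Relation.Unary.All as All using (All; []; _∷_)
open import Data.List.Relation.Unary.All.Properties as All using (++⁺; ++⁻)
open import Data.List.Relation.Unary.Any using (here; there)
open import Data.Maybe.Base using (Maybe; just; nothing; fromMaybe)
open import Data.Maybe.Properties using (just-injective)
open import Data.Nat.Base using (ℕ) renaming (suc to 1+_; _+_ to _ℕ+_)
open import Data.Product.Base using (∃; ∃₂; Σ-syntax; ∃-syntax; _×_; _,_; proj₁; proj₂)
open import Data.Sum.Base using (_⊎_; inj₁; inj₂; [_,_]; map₁)
open import Data.Sum.Function.Propositional using (_⊎-↣_)
open import Data.Unit.Polymorphic.Base using (⊤; tt)
open import Data.Vec.Base as Vec using (Vec; []; _∷_; lookup; map; tabulate; toList)
open import Data.Vec.Properties
  using (map-∘; map-++; lookup-map; lookup-++ˡ; lookup-++ʳ; tabulate-∘; tabulate-cong; tabulate∘lookup)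
open import Function.Base using (_∘_; id)
open import Function.Bundles using (_↣_; _⇔_; mk↣; mk⇔; _⟨$⟩_; Func; module Equivalence)
open import Function.Construct.Composition using (_↣-∘_)
open import Function.Construct.Identity using (↣-id)
import Function.Properties.Equivalence as ⇔
open import Level using (Lift; lift; lower; _⊔_) renaming (suc to ℓsuc)
open import Relation.Binary.PropositionalEquality
  using (_≡_; _≢_; _≗_; refl; sym; trans; cong; cong₂; cong-app; subst; subst₂)
import Relation.Binary.Reasoning.Setoid as SetoidReasoning
open import Relation.Nullary using (Dec; yes; no; does; ¬_; contradiction)
open import Relation.Nullary.Decidable using (True; toWitness; fromWitness)
open import Relation.Unary using (Pred; _∈_; _⊆_; _≐_; ∁)

open Automorphism using (to; from; strictlyInverseˡ; strictlyInverseʳ)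
open Equivalence using () renaming (to to ⇒; from to ⇐)
open Structure using () renaming (Carrier to ∣_∣)

-- Zorn's lemma and cardinal arithmetic

module Classical (em : ∀ a → ExcludedMiddle a) (ext : ∀ a b → Extensionality a b) where

  decide : ∀ {a} (P : Set a) → Dec P
  decide {a} P = em a

  ¬¬-elim : ∀ {a} {P : Set a} → ¬ ¬ P → P
  ¬¬-elim {P = P} ¬¬p with decide P
  ... | yes p = p
  ... | no ¬p = contradiction ¬p ¬¬p

  -- The set of elements generated from below by a function `next` and by
  -- suprema of chains is itself a chain (Bourbaki–Witt).
  module Tower {a} {A : Set a} (_≤_ : A → A → Set a)
    (≤-refl : ∀ {x} → x ≤ x) (≤-trans : ∀ {x y z} → x ≤ y → y ≤ z → x ≤ z)
    (≤-antisym : ∀ {x y} → x ≤ y → y ≤ x → x ≡ y) where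

    Chain : ∀ {c} → Pred A c → Set (a ⊔ c)
    Chain C = ∀ {x y} → x ∈ C → y ∈ C → x ≤ y ⊎ y ≤ x

    IsSupremum : Pred A a → A → Set a
    IsSupremum C s = (∀ {x} → x ∈ C → x ≤ s) × (∀ {y} → (∀ {x} → x ∈ C → x ≤ y) → s ≤ y)

    module _ (sup : ∀ C → Chain C → ∃ (IsSupremum C))
             (next : A → A) (≤-next : ∀ x → x ≤ next x) where

      data Tower : A → Set (ℓsuc a) where
        step  : ∀ {x} → Tower x → Tower (next x)
        limit : ∀ C (chain : Chain C) → (∀ {x} → x ∈ C → Tower x) → Tower (proj₁ (sup C chain))

      Extreme : A → Set (ℓsuc a)
      Extreme x = ∀ {y} → Tower y → y ≤ x → y ≢ x → next y ≤ x

      -- Induction on `y`. At a limit, either some member of the chain already lies above `next x`,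
      -- or all of them lie below `x`, and then so does their supremum.
      compare : ∀ {x y} → Extreme x → Tower y → y ≤ x ⊎ next x ≤ y
      compare {x} ex (step {y} ty) with compare ex ty
      ... | inj₂ nx≤y = inj₂ (≤-trans nx≤y (≤-next y))
      ... | inj₁ y≤x with decide (y ≡ x)
      ...   | yes refl = inj₂ ≤-refl
      ...   | no y≢x   = inj₁ (ex ty y≤x y≢x)
      compare {x} ex (limit C chain ts) with decide (∃[ c ] c ∈ C × next x ≤ c)
      ... | yes (c , c∈C , nx≤c) = inj₂ (≤-trans nx≤c (proj₁ (proj₂ (sup C chain)) c∈C))
      ... | no ¬above = inj₁ (proj₂ (proj₂ (sup C chain)) λ c∈C →
              [ id , (λ nx≤c → contradiction (_ , c∈C , nx≤c) ¬above) ] (compare ex (ts c∈C)))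

      -- At a limit, if no member of `C` lies above `y`, then `compare` puts every member below `y`,
      -- which forces `y` to be the supremum. If `y` lies below a member `c`, then extremality of
      -- `c` settles the case `y ≢ c`, and comparing `c` with the supremum itself settles `y ≡ c`.
      extreme : ∀ {x} → Tower x → Extreme x
      extreme (step {x} tx) {y} ty y≤nx y≢nx with compare (extreme tx) ty
      ... | inj₂ nx≤y = contradiction (≤-antisym y≤nx nx≤y) y≢nx
      ... | inj₁ y≤x with decide (y ≡ x)
      ...   | yes refl = ≤-refl
      ...   | no y≢x   = ≤-trans (extreme tx ty y≤x y≢x) (≤-next x)
      extreme t@(limit C chain ts) {y} ty y≤s y≢s with decide (∃[ c ] c ∈ C × y ≤ c)
      ... | no ¬below = contradiction (≤-antisym y≤s (least λ {c} c∈C →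
              [ (λ y≤c → contradiction (_ , c∈C , y≤c) ¬below) , ≤-trans (≤-next c) ]
                (compare (extreme (ts c∈C)) ty))) y≢s
        where least = proj₂ (proj₂ (sup C chain))
      ... | yes (c , c∈C , y≤c) with decide (y ≡ c)
      ...   | no y≢c   = ≤-trans (extreme (ts c∈C) ty y≤c y≢c) (proj₁ (proj₂ (sup C chain)) c∈C)
      ...   | yes refl with compare (extreme (ts c∈C)) t
      ...     | inj₁ s≤y  = contradiction (≤-antisym y≤s s≤y) y≢s
      ...     | inj₂ ny≤s = ny≤s

      -- The supremum of the whole tower belongs to the tower. So does its image under `next`, which
      -- therefore lies below it.
      fixedPoint : ∃[ x ] Tower x × next x ≤ x
      fixedPoint = s , ts , upper (lift (fromWitness (step ts)))
        where
        -- The tower as a predicate of lower level, so that its supremum exists.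
        C : Pred A a
        C x = Lift a (True (decide (Tower x)))

        C⊆Tower : ∀ {x} → x ∈ C → Tower x
        C⊆Tower (lift t) = toWitness t

        chain : Chain C
        chain x∈C y∈C with compare (extreme (C⊆Tower x∈C)) (C⊆Tower y∈C)
        ... | inj₁ y≤x  = inj₂ y≤x
        ... | inj₂ nx≤y = inj₁ (≤-trans (≤-next _) nx≤y)

        s = proj₁ (sup C chain)
        upper = proj₁ (proj₂ (sup C chain))
        ts = limit C chain C⊆Tower

    -- `next` chooses a strictly larger element of `P` whenever there is one, so its fixed points
    -- are maximal. The closure condition covers the empty chain, which makes `P` nonempty.
    zorn : (sup : ∀ C → Chain C → ∃ (IsSupremum C)) → ∀ {p} (P : Pred A p) →
           (∀ C (chain : Chain C) → C ⊆ P → proj₁ (sup C chain) ∈ P) →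
           ∃[ m ] m ∈ P × (∀ {x} → x ∈ P → m ≤ x → m ≡ x)
    zorn sup P P-sup = m , Tower⊆P tm , maximal
      where
      Above : A → A → Set _
      Above x y = y ∈ P × x ≤ y × x ≢ y

      next : A → A
      next x with decide (∃ (Above x))
      ... | yes (y , _) = y
      ... | no _        = x

      ≤-next : ∀ x → x ≤ next x
      ≤-next x with decide (∃ (Above x))
      ... | yes (_ , _ , x≤y , _) = x≤y
      ... | no _                  = ≤-refl

      next-P : ∀ {x} → x ∈ P → next x ∈ P
      next-P {x} x∈P with decide (∃ (Above x))
      ... | yes (_ , y∈P , _) = y∈P
      ... | no _              = x∈P

      Tower⊆P : ∀ {x} → Tower sup next ≤-next x → x ∈ P
      Tower⊆P (step t)           = next-P (Tower⊆P t)
      Tower⊆P (limit C chain ts) = P-sup C chain λ x∈C → Tower⊆P (ts x∈C)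

      m = proj₁ (fixedPoint sup next ≤-next)
      tm = proj₁ (proj₂ (fixedPoint sup next ≤-next))

      next-m≤m : next m ≤ m
      next-m≤m = proj₂ (proj₂ (fixedPoint sup next ≤-next))

      fixed⇒maximal : ∀ {x} → next x ≤ x → ∀ {y} → ¬ Above x y
      fixed⇒maximal {x} nx≤x above with decide (∃ (Above x))
      ... | yes (_ , _ , x≤y , x≢y) = x≢y (≤-antisym x≤y nx≤x)
      ... | no ¬above               = ¬above (_ , above)

      maximal : ∀ {x} → x ∈ P → m ≤ x → m ≡ x
      maximal x∈P m≤x = ¬¬-elim λ m≢x → fixed⇒maximal next-m≤m (x∈P , m≤x , m≢x)

  update : ∀ {a b} {A : Set a} {B : Set b} → (A → B) → A → B → A → B
  update f x y z with decide (x ≡ z)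
  ... | yes _ = y
  ... | no _  = f z

  update-same : ∀ {a b} {A : Set a} {B : Set b} (f : A → B) x y → update f x y x ≡ y
  update-same f x y with decide (x ≡ x)
  ... | yes _  = refl
  ... | no x≢x = contradiction refl x≢x

  update-other : ∀ {a b} {A : Set a} {B : Set b} (f : A → B) {x z} y → x ≢ z → update f x y z ≡ f z
  update-other f {x} {z} y x≢z with decide (x ≡ z)
  ... | yes x≡z = contradiction x≡z x≢z
  ... | no _    = refl

  update-cases : ∀ {a b} {A : Set a} {B : Set b} (f : A → B) {x z y w} → update f x y z ≡ w →
                 (x ≡ z × y ≡ w) ⊎ f z ≡ w
  update-cases f {x} {z} eq with decide (x ≡ z)
  ... | yes x≡z = inj₁ (x≡z , eq)
  ... | no _    = inj₂ eq

  -- Maximal partial functions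

  module _ {ℓ} {I V : Set ℓ} where

    Partial : Set ℓ
    Partial = I → Maybe V

    private
      _≤_ : Partial → Partial → Set ℓ
      d ≤ e = ∀ i v → d i ≡ just v → e i ≡ just v

      ≤-antisym : ∀ {d e} → d ≤ e → e ≤ d → d ≡ e
      ≤-antisym {d} {e} d≤e e≤d = ext ℓ ℓ pointwise
        where
        pointwise : ∀ i → d i ≡ e i
        pointwise i with d i in eq | e i in eq′
        ... | nothing | nothing = refl
        ... | just v  | _       = trans (sym (d≤e i v eq)) eq′
        ... | nothing | just v  = trans (sym eq) (e≤d i v eq′)

      open Tower _≤_ (λ _ _ eq → eq) (λ p q i v eq → q i v (p i v eq)) ≤-antisym

      module _ (C : Pred Partial ℓ) (chain : Chain C) where
        Value : I → Set ℓ
        Value i = ∃[ v ] ∃[ d ] d ∈ C × d i ≡ just v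

        union : Partial
        union i with decide (Value i)
        ... | yes (v , _) = just v
        ... | no _        = nothing

        union-value : ∀ i v → union i ≡ just v → ∃[ d ] d ∈ C × d i ≡ just v
        union-value i v eq with decide (Value i)
        union-value i v refl | yes (_ , d , d∈C , eq) = d , d∈C , eq

        value-union : ∀ {d} → d ∈ C → ∀ i v → d i ≡ just v → union i ≡ just v
        value-union {d} d∈C i v eq with decide (Value i)
        ... | no ¬value = contradiction (v , d , d∈C , eq) ¬value
        ... | yes (w , e , e∈C , eq′) with chain d∈C e∈C
        ...   | inj₁ d≤e = trans (sym eq′) (d≤e i v eq)
        ...   | inj₂ e≤d = trans (sym (e≤d i w eq′)) eq

        union-sup : IsSupremum C union
        union-sup = value-union , λ {e} bound i v eq →
          let (_ , d∈C , eq′) = union-value i v eq in bound d∈C i v eq′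

        -- Finitely many arguments involve only finitely many members of the chain, and the largest
        -- of these agrees with the union at all of them.
        union-local : ∃ C → ∀ is → ∃[ d ] d ∈ C × All (λ i → d i ≡ union i) is
        union-local (d , d∈C) [] = d , d∈C , []
        union-local inh (i ∷ is) with union-local inh is | union i in eq
        ... | d , d∈C , agree | nothing = d , d∈C , trans (undefined (d i) refl) (sym eq) ∷ agree
          where
          undefined : ∀ x → d i ≡ x → d i ≡ nothing
          undefined nothing  eq′ = eq′
          undefined (just v) eq′ with () ← trans (sym eq) (value-union d∈C i v eq′)
        ... | d , d∈C , agree | just v with union-value i v eq
        ...   | e , e∈C , eᵢ with chain d∈C e∈C
        ...     | inj₁ d≤e = e , e∈C , trans eᵢ (sym eq) ∷ All.map (λ {k} → larger k) agree
          where
          larger : ∀ k → d k ≡ union k → e k ≡ union k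
          larger k dₖ with d k in eq′ | e k in eq″
          ... | just w  | _       = trans (sym eq″) (trans (d≤e k w eq′) dₖ)
          ... | nothing | nothing = dₖ
          ... | nothing | just w  = sym (value-union e∈C k w eq″)
        ...     | inj₂ e≤d = d , d∈C , trans (e≤d i v eᵢ) (sym eq) ∷ agree

    -- The last hypothesis says that `P` can be checked on finite sets of arguments. By
    -- `union-local` this closes `P` under unions of nonempty chains; the empty partial function
    -- takes care of the empty chain.
    maximalPartial : ∀ {p} (P : Pred Partial p) → P (λ _ → nothing) →
      (∀ d → (∀ is → ∃[ e ] e ∈ P × All (λ i → e i ≡ d i) is) → d ∈ P) →
      ∃[ d ] d ∈ P × (∀ {i} v → d i ≡ nothing → ¬ P (update d i (just v)))
    maximalPartial P P-empty P-local = m , m∈P , undefined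
      where
      P-union : ∀ C (chain : Chain C) → C ⊆ P → union C chain ∈ P
      P-union C chain C⊆P with decide (∃ C)
      ... | yes inh = P-local _ λ is →
              let (d , d∈C , agree) = union-local C chain inh is in d , C⊆P d∈C , agree
      ... | no empty = P-local _ λ is → _ , P-empty , All.universal nowhere is
        where
        nowhere : ∀ i → nothing ≡ union C chain i
        nowhere i with union C chain i in eq
        ... | nothing = refl
        ... | just v  = let (d , d∈C , _) = union-value C chain i v eq in contradiction (d , d∈C) empty

      z = zorn (λ C chain → union C chain , union-sup C chain) P P-union
      m = proj₁ z
      m∈P = proj₁ (proj₂ z)

      undefined : ∀ {i} v → m i ≡ nothing → ¬ P (update m i (just v))
      undefined {i} v mᵢ p = nothing≢just
          (trans (sym mᵢ) (trans (cong-app (proj₂ (proj₂ z) p extends) i) (update-same m i (just v))))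
        where
        nothing≢just : ∀ {w : V} → nothing ≢ just w
        nothing≢just ()

        extends : m ≤ update m i (just v)
        extends k w eq = trans (update-other m (just v) i≢k) eq
          where
          i≢k : i ≢ k
          i≢k refl = nothing≢just (trans (sym mᵢ) eq)

    -- The form of Zorn's lemma behind both `realize` and `evaluation`: a maximal partial function
    -- is total, because an undefined place could still be filled.
    totalPartial : ∀ {p} (P : Pred Partial p) → P (λ _ → nothing) →
      (∀ d → (∀ is → ∃[ e ] e ∈ P × All (λ i → e i ≡ d i) is) → d ∈ P) →
      (∀ d → d ∈ P → ∀ i → d i ≡ nothing → ∃[ v ] P (update d i (just v))) →
      ∃[ f ] P (just ∘ f)
    totalPartial P P-empty P-local P-extend = (λ i → proj₁ (value i)) ,
      subst P (ext ℓ ℓ λ i → proj₂ (value i)) (proj₁ (proj₂ maximal))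
      where
      maximal = maximalPartial P P-empty P-local
      d = proj₁ maximal

      value : ∀ i → ∃[ v ] d i ≡ just v
      value i with d i in eq
      ... | just v  = v , refl
      ... | nothing = let (v , p) = P-extend d (proj₁ (proj₂ maximal)) i eq in
                      contradiction p (proj₂ (proj₂ maximal) v eq)

  -- Comparison of cardinals and sums below a strong limit

  module _ {ℓ} (A B : Set ℓ) where
    private
      IsInjective : Pred (A → Maybe B) ℓ
      IsInjective d = ∀ {x y b} → d x ≡ just b → d y ≡ just b → x ≡ y

      local : ∀ d → (∀ is → ∃[ e ] e ∈ IsInjective × All (λ i → e i ≡ d i) is) → d ∈ IsInjective
      local d approx {x} {y} dx dy with approx (x ∷ y ∷ [])
      ... | _ , inj , ex ∷ ey ∷ [] = inj (trans ex dx) (trans ey dy)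

      maximal = maximalPartial IsInjective (λ ()) local
      d = proj₁ maximal

      d-injective : d ∈ IsInjective
      d-injective = proj₁ (proj₂ maximal)

      extension-injective : ∀ {a b} → ¬ (∃[ x ] d x ≡ just b) → update d a (just b) ∈ IsInjective
      extension-injective {a} ¬hit {x} {y} dx dy with decide (a ≡ x) | decide (a ≡ y)
      ... | yes refl | yes refl = refl
      ... | yes _    | no _     = contradiction (y , trans dy (sym dx)) ¬hit
      ... | no _     | yes _    = contradiction (x , trans dx (sym dy)) ¬hit
      ... | no _     | no _     = d-injective dx dy

    comparable : (A ↣ B) ⊎ (B ↣ A)
    comparable with decide (∃[ a ] d a ≡ nothing)
    ... | no total = inj₁ (mk↣ {to = λ a → proj₁ (value a)} λ {x} {y} eq →
            d-injective (proj₂ (value x)) (trans (proj₂ (value y)) (cong just (sym eq))))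
      where
      value : ∀ a → ∃[ b ] d a ≡ just b
      value a with d a in eq
      ... | just b  = b , refl
      ... | nothing = contradiction (a , eq) total
    ... | yes (a , undefined) = inj₂ (mk↣ {to = λ b → proj₁ (preimage b)} λ {x} {y} eq →
            just-injective (trans (sym (proj₂ (preimage x))) (trans (cong d eq) (proj₂ (preimage y)))))
      where
      preimage : ∀ b → ∃[ x ] d x ≡ just b
      preimage b = ¬¬-elim λ ¬hit →
        proj₂ (proj₂ maximal) b undefined λ {x} {y} → extension-injective ¬hit {x} {y}

  ↣-<ᶜ : ∀ {ℓ} {A B κ : Set ℓ} → A ↣ B → B <ᶜ κ → A <ᶜ κ
  ↣-<ᶜ A↣B (B↣κ , ¬κ↣B) = B↣κ ↣-∘ A↣B , λ κ↣A → ¬κ↣B (A↣B ↣-∘ κ↣A)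

  -- The left copy of `a` goes to the principal ultrafilter at `a` and the right copy to its
  -- complement. Evaluation at the full set tells the copies apart, evaluation at singletons the
  -- elements. Two power sets stay below a strong limit.
  ⊎↣powerset² : ∀ {ℓ} (A : Set ℓ) → (A ⊎ A) ↣ ((A → Bool) → Bool)
  ⊎↣powerset² A = mk↣ {to = embed} injective
    where
    embed : A ⊎ A → (A → Bool) → Bool
    embed (inj₁ a) s = s a
    embed (inj₂ a) s = not (s a)

    at-singleton : ∀ a b → does (decide (a ≡ a)) ≡ does (decide (a ≡ b)) → a ≡ b
    at-singleton a b eq with decide (a ≡ a) | decide (a ≡ b)
    ... | _      | yes a≡b = a≡b
    ... | no a≢a | no _    = contradiction refl a≢a
    at-singleton a b () | yes _ | no _

    injective : ∀ {x y} → embed x ≡ embed y → x ≡ y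
    injective {inj₁ a} {inj₁ b} eq = cong inj₁ (at-singleton a b (cong-app eq λ c → does (decide (a ≡ c))))
    injective {inj₂ a} {inj₂ b} eq =
      cong inj₂ (at-singleton a b (not-injective (cong-app eq λ c → does (decide (a ≡ c)))))
    injective {inj₁ a} {inj₂ b} eq with () ← cong-app eq (λ _ → true)
    injective {inj₂ a} {inj₁ b} eq with () ← cong-app eq (λ _ → true)

  ⊎-<ᶜ : ∀ {ℓ} {A B κ : Set ℓ} → IsStrongLimit κ → A <ᶜ κ → B <ᶜ κ → (A ⊎ B) <ᶜ κ
  ⊎-<ᶜ {A = A} {B} strong A<κ B<κ with comparable A B
  ... | inj₁ A↣B = ↣-<ᶜ (⊎↣powerset² B ↣-∘ (A↣B ⊎-↣ ↣-id B)) (strong _ (strong _ B<κ))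
  ... | inj₂ B↣A = ↣-<ᶜ (⊎↣powerset² A ↣-∘ (↣-id A ⊎-↣ B↣A)) (strong _ (strong _ A<κ))

-- Realizing types in fewer than κ variables

module _ {ℓ} {L : Language ℓ} where

  renameTerm  : ∀ {n m} → (Fin n → Fin m) → Term L n → Term L m
  renameTerms : ∀ {n m k} → (Fin n → Fin m) → Vec (Term L n) k → Vec (Term L m) k
  renameTerm ρ (var i)    = var (ρ i)
  renameTerm ρ (fun f ts) = fun f (renameTerms ρ ts)
  renameTerms ρ []        = []
  renameTerms ρ (t ∷ ts)  = renameTerm ρ t ∷ renameTerms ρ ts

  rename : ∀ {n m} → (Fin n → Fin m) → Formula L n → Formula L m
  rename ρ (equal s t)   = equal (renameTerm ρ s) (renameTerm ρ t)
  rename ρ (rel R ts)    = rel R (renameTerms ρ ts)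
  rename ρ falsum        = falsum
  rename ρ (implies φ ψ) = implies (rename ρ φ) (rename ρ ψ)
  rename ρ (forAll φ)    = forAll (rename (liftᶠ 1 ρ) φ)

  module _ (N : Structure L) where
    open Structure N using (relᴹ; funᴹ)

    module _ {n m} (ρ : Fin n → Fin m) {v : Vec ∣ N ∣ n} {w : Vec ∣ N ∣ m}
             (eq : ∀ i → lookup v i ≡ lookup w (ρ i)) where
      eval-rename  : ∀ t → eval N v t ≡ eval N w (renameTerm ρ t)
      evals-rename : ∀ {k} (ts : Vec _ k) → evals N v ts ≡ evals N w (renameTerms ρ ts)
      eval-rename (var i)     = eq i
      eval-rename (fun f ts)  = cong (funᴹ f) (evals-rename ts)
      evals-rename []         = refl
      evals-rename (t ∷ ts)   = cong₂ _∷_ (eval-rename t) (evals-rename ts)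

    Sat-rename : ∀ {n m} (ρ : Fin n → Fin m) {v w} → (∀ i → lookup v i ≡ lookup w (ρ i)) →
                 ∀ φ → Sat N φ v ⇔ Sat N (rename ρ φ) w
    Sat-rename ρ eq (equal s t) = mk⇔
      (subst₂ _≡_ (eval-rename ρ eq s) (eval-rename ρ eq t))
      (subst₂ _≡_ (sym (eval-rename ρ eq s)) (sym (eval-rename ρ eq t)))
    Sat-rename ρ eq (rel R ts) = mk⇔
      (subst (relᴹ R) (evals-rename ρ eq ts)) (subst (relᴹ R) (sym (evals-rename ρ eq ts)))
    Sat-rename ρ eq falsum = ⇔.refl
    Sat-rename ρ eq (implies φ ψ) = mk⇔
      (λ h → ⇒ (Sat-rename ρ eq ψ) ∘ h ∘ ⇐ (Sat-rename ρ eq φ))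
      (λ h → ⇐ (Sat-rename ρ eq ψ) ∘ h ∘ ⇒ (Sat-rename ρ eq φ))
    Sat-rename ρ {v} {w} eq (forAll φ) = mk⇔
      (λ h x → ⇒ (Sat-rename (liftᶠ 1 ρ) (lifted x) φ) (h x))
      (λ h x → ⇐ (Sat-rename (liftᶠ 1 ρ) (lifted x) φ) (h x))
      where
      lifted : ∀ x i → lookup (x ∷ v) i ≡ lookup (x ∷ w) (liftᶠ 1 ρ i)
      lifted x zero    = refl
      lifted x (suc i) = eq i

-- ParamFormula L X A is OpenFormula L (X ⊎ A), and SatParam N x a is Holds N [ x , a ].
OpenFormula : ∀ {ℓ} → Language ℓ → Set ℓ → Set ℓ
OpenFormula L Z = Σ[ n ∈ ℕ ] Formula L n × Vec Z n

module _ {ℓ} {L : Language ℓ} where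

  variables : ∀ {Z : Set ℓ} → OpenFormula L Z → List Z
  variables (_ , _ , v) = toList v

  substitute : ∀ {Y Z : Set ℓ} → (Y → Z) → OpenFormula L Y → OpenFormula L Z
  substitute f (n , φ , v) = n , φ , map f v

  Holds : (N : Structure L) {Z : Set ℓ} → (Z → ∣ N ∣) → OpenFormula L Z → Set ℓ
  Holds N e (_ , φ , v) = Sat N φ (map e v)

  module _ {Z : Set ℓ} where
    truth : OpenFormula L Z
    truth = 0 , neg falsum , []

    negation : OpenFormula L Z → OpenFormula L Z
    negation (n , φ , v) = n , neg φ , v

    implication : OpenFormula L Z → OpenFormula L Z → OpenFormula L Z
    implication (n , φ , v) (m , ψ , w) =
      n ℕ+ m , implies (rename (_↑ˡ m) φ) (rename (n ↑ʳ_) ψ) , v Vec.++ w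

    conjunction : List (OpenFormula L Z) → OpenFormula L Z
    conjunction []       = truth
    conjunction (θ ∷ θs) = negation (implication θ (negation (conjunction θs)))

  module _ (N : Structure L) {Z : Set ℓ} where

    Holds-cong-∈ : ∀ {e e′ : Z → ∣ N ∣} θ → (∀ z → z ∈ᴸ variables θ → e z ≡ e′ z) →
                   Holds N e θ → Holds N e′ θ
    Holds-cong-∈ {e} {e′} (_ , φ , v) eq = subst (Sat N φ) (maps v eq)
      where
      maps : ∀ {k} (v : Vec Z k) → (∀ z → z ∈ᴸ toList v → e z ≡ e′ z) → map e v ≡ map e′ v
      maps []      eq = refl
      maps (z ∷ v) eq = cong₂ _∷_ (eq z (here refl)) (maps v λ z z∈v → eq z (there z∈v))

    Holds-cong : ∀ {e e′ : Z → ∣ N ∣} → e ≗ e′ → ∀ θ → Holds N e θ → Holds N e′ θ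
    Holds-cong eq θ = Holds-cong-∈ θ λ z _ → eq z

    Holds-substitute : ∀ {Y : Set ℓ} (f : Y → Z) e θ → Holds N e (substitute f θ) ⇔ Holds N (e ∘ f) θ
    Holds-substitute f e (_ , φ , v) = mk⇔ (subst (Sat N φ) (sym (map-∘ e f v))) (subst (Sat N φ) (map-∘ e f v))

    Holds-to : ∀ (σ : Automorphism N) (e : Z → ∣ N ∣) θ → Holds N e θ ⇔ Holds N (Automorphism.to σ ∘ e) θ
    Holds-to σ e (_ , φ , v) = subst (λ w → Sat N φ (map e v) ⇔ Sat N φ w)
      (sym (map-∘ (Automorphism.to σ) e v)) (Sat-to σ φ (map e v))

    Holds-implication : ∀ (e : Z → ∣ N ∣) θ χ → Holds N e (implication θ χ) ⇔ (Holds N e θ → Holds N e χ)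
    Holds-implication e (n , φ , v) (m , ψ , w) =
      mk⇔ (λ h → ⇐ right ∘ h ∘ ⇒ left) (λ h → ⇒ right ∘ h ∘ ⇐ left)
      where
      left : Sat N φ (map e v) ⇔ Sat N (rename (_↑ˡ m) φ) (map e (v Vec.++ w))
      left = Sat-rename N (_↑ˡ m) (λ i → trans (sym (lookup-++ˡ (map e v) (map e w) i))
               (cong (λ u → lookup u (i ↑ˡ m)) (sym (map-++ e v w)))) φ
      right : Sat N ψ (map e w) ⇔ Sat N (rename (n ↑ʳ_) ψ) (map e (v Vec.++ w))
      right = Sat-rename N (n ↑ʳ_) (λ i → trans (sym (lookup-++ʳ (map e v) (map e w) i))
                (cong (λ u → lookup u (n ↑ʳ i)) (sym (map-++ e v w)))) ψ

-- Existential quantification and saturation for tuples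

module Saturation (em : ∀ a → ExcludedMiddle a) (ext : ∀ a b → Extensionality a b)
                  {ℓ} {L : Language ℓ} where
  open Classical em ext

  module _ (N : Structure L) {Z : Set ℓ} where

    Holds-negation : ∀ (e : Z → ∣ N ∣) θ → Holds N e (negation θ) ⇔ (¬ Holds N e θ)
    Holds-negation e (_ , _ , _) = mk⇔ (λ h t → ⊥-elim (h t)) (λ h t → contradiction t h)

    Holds-conjunction : ∀ (e : Z → ∣ N ∣) θs → Holds N e (conjunction θs) ⇔ All (Holds N e) θs
    Holds-conjunction e [] = mk⇔ (λ _ → []) (λ _ → id)
    Holds-conjunction e (θ ∷ θs) = mk⇔
      (λ h → let ¬imp = ⇒ (Holds-negation e (implication θ ¬rest)) h in
        ¬¬-elim (λ ¬θ → ¬imp (⇐ imp λ t → contradiction t ¬θ)) ∷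
        ⇒ rest (¬¬-elim λ ¬θs → ¬imp (⇐ imp λ _ → ⇐ neg-rest ¬θs)))
      (λ { (t ∷ ts) → ⇐ (Holds-negation e (implication θ ¬rest))
        λ h → ⇒ neg-rest (⇒ imp h t) (⇐ rest ts) })
      where
      ¬rest    = negation (conjunction θs)
      imp      = Holds-implication N e θ ¬rest
      rest     = Holds-conjunction e θs
      neg-rest = Holds-negation e (conjunction θs)

  module _ {Z : Set ℓ} where
    private
      bind : ∀ {n} → Z → Vec Z n → Fin n → Fin (1+ n)
      bind z v k with decide (z ≡ lookup v k)
      ... | yes _ = zero
      ... | no _  = suc k

    -- `bind` redirects every position that holds `z` to the quantified variable. The vector `v` can
    -- then be kept unchanged, its entries `z` being dummies.
    exists : Z → OpenFormula L Z → OpenFormula L Z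
    exists z (n , φ , v) = n , neg (forAll (neg (rename (bind z v) φ))) , v

    existsAll : List Z → OpenFormula L Z → OpenFormula L Z
    existsAll []       θ = θ
    existsAll (z ∷ zs) θ = exists z (existsAll zs θ)

    module _ (N : Structure L) where

      Holds-exists : ∀ e z θ → Holds N e (exists z θ) ⇔ (∃[ c ] Holds N (update e z c) θ)
      Holds-exists e z (n , φ , v) = mk⇔
        (λ h → ¬¬-elim λ none → ⊥-elim (h λ c s → contradiction (c , ⇐ (body c) s) none))
        (λ { (c , s) h → h c (⇒ (body c) s) })
        where
        entry : ∀ c k → lookup (map (update e z c) v) k ≡ lookup (c ∷ map e v) (bind z v k)
        entry c k rewrite lookup-map k (update e z c) v with decide (z ≡ lookup v k)
        ... | yes _ = refl
        ... | no _  = sym (lookup-map k e v)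

        body : ∀ c → Sat N φ (map (update e z c) v) ⇔ Sat N (rename (bind z v) φ) (c ∷ map e v)
        body c = Sat-rename N (bind z v) (entry c) φ

      Holds-existsAll⁻ : ∀ e zs θ → Holds N e (existsAll zs θ) →
        ∃[ e′ ] Holds N e′ θ × (∀ z → ¬ (z ∈ᴸ zs) → e′ z ≡ e z)
      Holds-existsAll⁻ e [] θ h = e , h , λ _ _ → refl
      Holds-existsAll⁻ e (z ∷ zs) θ h with ⇒ (Holds-exists e z (existsAll zs θ)) h
      ... | c , h′ with Holds-existsAll⁻ (update e z c) zs θ h′
      ...   | e′ , h″ , agree = e′ , h″ , λ x x∉ →
        trans (agree x (x∉ ∘ there)) (update-other e c λ { refl → x∉ (here refl) })

      Holds-existsAll⁺ : ∀ e zs θ e′ → Holds N e′ θ →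
        (∀ z → z ∈ᴸ variables θ → z ∈ᴸ zs ⊎ e′ z ≡ e z) → Holds N e (existsAll zs θ)
      Holds-existsAll⁺ e [] θ e′ h agree = Holds-cong-∈ N θ (λ z z∈ → [ (λ ()) , id ] (agree z z∈)) h
      Holds-existsAll⁺ e (z ∷ zs) θ e′ h agree =
        ⇐ (Holds-exists e z (existsAll zs θ)) (e′ z , Holds-existsAll⁺ _ zs θ e′ h agree′)
        where
        agree′ : ∀ x → x ∈ᴸ variables θ → x ∈ᴸ zs ⊎ e′ x ≡ update e z (e′ z) x
        agree′ x x∈ with decide (z ≡ x) | agree x x∈
        ... | yes refl | _                = inj₂ refl
        ... | no z≢x   | inj₁ (here x≡z)  = contradiction (sym x≡z) z≢x
        ... | no _     | inj₁ (there x∈z) = inj₁ x∈z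
        ... | no _     | inj₂ eq          = inj₂ eq

  module _ (N : Structure L) {κ : Set ℓ} (saturated : IsSaturated N κ)
           {Z : Set ℓ} (Z<κ : Z <ᶜ κ) (Γ : Pred (OpenFormula L Z) ℓ)
           (satisfiable : ∀ θs → All Γ θs → ∃[ x ] All (Holds N x) θs) where
    private
      Agrees : (Z → Maybe ∣ N ∣) → (Z → ∣ N ∣) → Z → Set ℓ
      Agrees d x z = ∀ c → d z ≡ just c → x z ≡ c

      -- The values of `d` are imposed only at the finitely many places `zs`. This makes the
      -- property local, as `totalPartial` requires.
      Consistent : Pred (Z → Maybe ∣ N ∣) ℓ
      Consistent d = ∀ θs → All Γ θs → ∀ zs → ∃[ x ] All (Holds N x) θs × All (Agrees d x) zs

      empty-consistent : Consistent (λ _ → nothing)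
      empty-consistent θs θs⊆Γ zs =
        let (x , h) = satisfiable θs θs⊆Γ in x , h , All.universal (λ _ _ ()) zs

      local : ∀ d → (∀ zs → ∃[ e ] e ∈ Consistent × All (λ z → e z ≡ d z) zs) → d ∈ Consistent
      local d approx θs θs⊆Γ zs with approx zs
      ... | e , e-consistent , e≡d with e-consistent θs θs⊆Γ zs
      ...   | x , h , agrees = x , h ,
        All.zipWith (λ (eq , agree) c dz → agree c (trans eq dz)) (e≡d , agrees)

      module Extend (d : Z → Maybe ∣ N ∣) (consistent : Consistent d)
                    (i : Z) (undefined : d i ≡ nothing) where

        parameter : Z → ∣ N ∣
        parameter z = fromMaybe (Structure.nonempty N) (d z)

        -- Places with a value become parameters, all others the one free variable. Among the latter
        -- only `i` matters, because `residue` quantifies the rest away, and the default in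
        -- `parameter` is never read.
        slot : Z → ⊤ {ℓ} ⊎ Z
        slot z with d z
        ... | just _  = inj₂ z
        ... | nothing = inj₁ tt

        Free : Z → Set ℓ
        Free z = d z ≡ nothing × z ≢ i

        free : List (OpenFormula L Z) → List Z
        free θs = filter (λ z → decide (Free z)) (variables (conjunction θs))

        -- The condition on the value at i that θs can be realized by an
        -- extension of d.
        residue : List (OpenFormula L Z) → ParamFormula L ⊤ Z
        residue θs = substitute slot (existsAll (free θs) (conjunction θs))

        env : ∣ N ∣ → Z → ∣ N ∣
        env c z = [ (λ _ → c) , parameter ] (slot z)

        env-defined : ∀ c {z b} → d z ≡ just b → env c z ≡ b
        env-defined c {z} eq with d z in eq′
        env-defined c {z} refl | just b rewrite eq′ = refl

        env-undefined : ∀ c {z} → d z ≡ nothing → env c z ≡ c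
        env-undefined c {z} eq with d z
        env-undefined c {z} refl | nothing = refl

        status : (m : Maybe ∣ N ∣) → (∃[ b ] m ≡ just b) ⊎ m ≡ nothing
        status (just b) = inj₁ (b , refl)
        status nothing  = inj₂ refl

        residue⁺ : ∀ θs x → All (Holds N x) θs → All (Agrees d x) (variables (conjunction θs)) →
                   SatParam N (λ _ → x i) parameter (residue θs)
        residue⁺ θs x h agrees = ⇐ (Holds-substitute N slot _ (existsAll (free θs) (conjunction θs)))
          (Holds-existsAll⁺ N (env (x i)) (free θs) (conjunction θs) x
            (⇐ (Holds-conjunction N x θs) h) cases)
          where
          cases : ∀ z → z ∈ᴸ variables (conjunction θs) → z ∈ᴸ free θs ⊎ x z ≡ env (x i) z
          cases z z∈ with status (d z) | decide (z ≡ i)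
          ... | inj₁ (b , eq) | _        = inj₂ (trans (All.lookup agrees z∈ b eq) (sym (env-defined (x i) eq)))
          ... | inj₂ eq       | yes refl = inj₂ (sym (env-undefined (x i) eq))
          ... | inj₂ eq       | no z≢i   = inj₁ (∈-filter⁺ (λ z → decide (Free z)) z∈ (eq , z≢i))

        residue⁻ : ∀ θs c → SatParam N (λ _ → c) parameter (residue θs) →
                   ∃[ x ] All (Holds N x) θs × (∀ z → Agrees (update d i (just c)) x z)
        residue⁻ θs c s
          with Holds-existsAll⁻ N (env c) (free θs) (conjunction θs)
                 (⇒ (Holds-substitute N slot _ (existsAll (free θs) (conjunction θs))) s)
        ... | x , h , agree = x , ⇒ (Holds-conjunction N x θs) h , agrees
          where
          not-free : ∀ {z} → ¬ Free z → x z ≡ env c z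
          not-free ¬free = agree _ λ z∈ →
            ¬free (proj₂ (∈-filter⁻ (λ z → decide (Free z)) {xs = variables (conjunction θs)} z∈))

          agrees : ∀ z → Agrees (update d i (just c)) x z
          agrees z b eq with decide (i ≡ z)
          agrees z b refl | yes refl = trans (not-free λ (_ , z≢i) → z≢i refl) (env-undefined c undefined)
          agrees z b eq   | no _     =
            trans (not-free λ { (eq′ , _) → nothing≢just (trans (sym eq′) eq) }) (env-defined c eq)
            where
            nothing≢just : ∀ {b : ∣ N ∣} → ¬ (nothing ≡ just b)
            nothing≢just ()

        Residues : Pred (ParamFormula L ⊤ Z) ℓ
        Residues ψ = ∃[ θs ] All Γ θs × ψ ≡ residue θs

        -- Finitely many residues come from one finite subset of `Γ` and refer to finitely many
        -- values of `d`, so consistency of `d` supplies a single assignment for all of them.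
        collect : ∀ ψs → All Residues ψs → ∃₂ λ θs zs → All Γ θs ×
          (∀ x → All (Holds N x) θs → All (Agrees d x) zs → All (SatParam N (λ _ → x i) parameter) ψs)
        collect [] [] = [] , [] , [] , λ _ _ _ → []
        collect (_ ∷ ψs) ((θs , θs⊆Γ , refl) ∷ rs) with collect ψs rs
        ... | θs′ , zs , θs′⊆Γ , k =
          θs ++ θs′ , variables (conjunction θs) ++ zs , ++⁺ θs⊆Γ θs′⊆Γ , λ x h agrees →
            let (h₁ , h₂) = ++⁻ θs h
                (a₁ , a₂) = ++⁻ (variables (conjunction θs)) agrees
            in residue⁺ θs x h₁ a₁ ∷ k x h₂ a₂

        value : ∃[ c ] Residues ⊆ SatParam N (λ _ → c) parameter
        value = saturated Z Z<κ parameter Residues λ ψs rs →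
          let (θs , zs , θs⊆Γ , k) = collect ψs rs
              (x , h , agrees) = consistent θs θs⊆Γ zs
          in x i , k x h agrees

        extended : ∃[ c ] Consistent (update d i (just c))
        extended = proj₁ value , λ θs θs⊆Γ zs →
          let (x , h , agrees) = residue⁻ θs (proj₁ value) (proj₂ value (θs , θs⊆Γ , refl))
          in x , h , All.universal agrees zs

    abstract
      -- Saturation speaks of one variable at a time. The values are therefore chosen successively,
      -- each one realizing the residues left by the values fixed before it.
      realize : ∃[ x ] Γ ⊆ Holds N x
      realize = realizes (totalPartial Consistent empty-consistent local Extend.extended)
        where
        realizes : ∃[ x ] Consistent (just ∘ x) → ∃[ x ] Γ ⊆ Holds N x
        realizes (x , consistent) = x , λ {θ} θ∈Γ → holds θ (consistent (θ ∷ []) (θ∈Γ ∷ []) (variables θ))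
          where
          holds : ∀ θ → ∃[ y ] All (Holds N y) (θ ∷ []) × All (Agrees (just ∘ x) y) (variables θ) →
                  Holds N x θ
          holds θ (_ , h ∷ [] , agrees) = Holds-cong-∈ N θ (λ z z∈ → All.lookup agrees z∈ (x z) refl) h

-- Galois groups

IsConjugationInvariant : ∀ {ℓ n} (G : Group ℓ ℓ) → Pred (Group.Carrier G) n → Set (ℓ ⊔ n)
IsConjugationInvariant G S = ∀ g {x} → x ∈ S → (g ∙ x) ∙ g ⁻¹ ∈ S
  where open Group G

module _ {ℓ n} (G : Group ℓ ℓ) {S : Pred (Group.Carrier G) n}
         (S-normal : IsConjugationInvariant G S) where
  open Group G hiding (refl; sym; trans; identity; inverse)
  open Group G using () renaming (refl to ≈-refl; sym to ≈-sym; trans to ≈-trans)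
  open GroupProperties G
  open SetoidReasoning setoid

  private
    N : Pred Carrier (ℓ ⊔ n)
    N = Generated G S

  conjugate-product : ∀ g x y → (g ∙ x) ∙ g ⁻¹ ∙ ((g ∙ y) ∙ g ⁻¹) ≈ (g ∙ (x ∙ y)) ∙ g ⁻¹
  conjugate-product g x y = begin
    (g ∙ x) ∙ g ⁻¹ ∙ ((g ∙ y) ∙ g ⁻¹)   ≈⟨ assoc (g ∙ x) (g ⁻¹) _ ⟩
    (g ∙ x) ∙ (g ⁻¹ ∙ ((g ∙ y) ∙ g ⁻¹)) ≈⟨ ∙-congˡ (∙-congˡ (assoc g y (g ⁻¹))) ⟩
    (g ∙ x) ∙ (g ⁻¹ ∙ (g ∙ (y ∙ g ⁻¹))) ≈⟨ ∙-congˡ (\\-leftDividesʳ g (y ∙ g ⁻¹)) ⟩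
    (g ∙ x) ∙ (y ∙ g ⁻¹)                ≈⟨ assoc (g ∙ x) y (g ⁻¹) ⟨
    ((g ∙ x) ∙ y) ∙ g ⁻¹                ≈⟨ ∙-congʳ (assoc g x y) ⟩
    (g ∙ (x ∙ y)) ∙ g ⁻¹                ∎

  conjugate-identity : ∀ g → (g ∙ ε) ∙ g ⁻¹ ≈ ε
  conjugate-identity g = ≈-trans (∙-congʳ (identityʳ g)) (inverseʳ g)

  conjugate-inverse : ∀ g x → ((g ∙ x) ∙ g ⁻¹) ⁻¹ ≈ (g ∙ x ⁻¹) ∙ g ⁻¹
  conjugate-inverse g x = begin
    ((g ∙ x) ∙ g ⁻¹) ⁻¹    ≈⟨ ⁻¹-anti-homo-∙ (g ∙ x) (g ⁻¹) ⟩
    (g ⁻¹) ⁻¹ ∙ (g ∙ x) ⁻¹ ≈⟨ ∙-cong (⁻¹-involutive g) (⁻¹-anti-homo-∙ g x) ⟩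
    g ∙ (x ⁻¹ ∙ g ⁻¹)      ≈⟨ assoc g (x ⁻¹) (g ⁻¹) ⟨
    (g ∙ x ⁻¹) ∙ g ⁻¹      ∎

  Generated-normal : ∀ g {x} → x ∈ N → (g ∙ x) ∙ g ⁻¹ ∈ N
  Generated-normal g (generator x∈S)          = generator (S-normal g x∈S)
  Generated-normal g identity                 = resp-≈ (≈-sym (conjugate-identity g)) identity
  Generated-normal g (product {x} {y} hx hy)  =
    resp-≈ (conjugate-product g x y) (product (Generated-normal g hx) (Generated-normal g hy))
  Generated-normal g (inverse {x} hx)         =
    resp-≈ (conjugate-inverse g x) (inverse (Generated-normal g hx))
  Generated-normal g (resp-≈ x≈y hx)          =
    resp-≈ (∙-congʳ (∙-congˡ x≈y)) (Generated-normal g hx)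

  Generated-normal′ : ∀ g {x} → x ∈ N → g ⁻¹ ∙ (x ∙ g) ∈ N
  Generated-normal′ g {x} hx = resp-≈
    (≈-trans (∙-congˡ (⁻¹-involutive g)) (assoc (g ⁻¹) x g)) (Generated-normal (g ⁻¹) hx)

  open RawGroup (quotientGroup rawGroup N) using () renaming (_≈_ to _~_)

  ~-intro : ∀ {x y h} → h ∈ N → y ≈ x ∙ h → x ~ y
  ~-intro {x} {y} {h} h∈N y≈xh =
    (λ (k , k∈N , z≈xk) → h ⁻¹ ∙ k , product (inverse h∈N) k∈N , ≈-trans z≈xk (begin
      x ∙ k                ≈⟨ ∙-congˡ (\\-leftDividesˡ h k) ⟨
      x ∙ (h ∙ (h ⁻¹ ∙ k)) ≈⟨ assoc x h _ ⟨
      (x ∙ h) ∙ (h ⁻¹ ∙ k) ≈⟨ ∙-congʳ y≈xh ⟨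
      y ∙ (h ⁻¹ ∙ k)       ∎)) ,
    (λ (k , k∈N , z≈yk) → h ∙ k , product h∈N k∈N ,
      ≈-trans z≈yk (≈-trans (∙-congʳ y≈xh) (assoc x h k)))

  ~-elim : ∀ {x y} → x ~ y → ∃[ h ] h ∈ N × y ≈ x ∙ h
  ~-elim {y = y} x~y = proj₂ x~y (ε , identity , ≈-sym (identityʳ y))

  ≈⇒~ : ∀ {x y} → x ≈ y → x ~ y
  ≈⇒~ {x} x≈y = ~-intro identity (≈-trans (≈-sym x≈y) (≈-sym (identityʳ x)))

  -- Equality and operations are those of `quotientGroup`, so the raw group underlying `galoisGroup`
  -- is definitionally that of `Gal-L`. Well-definedness of the operations comes from normality of
  -- `N`.
  quotient : Group ℓ (ℓ ⊔ n)
  quotient = record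
    { Carrier = Carrier
    ; _≈_ = _~_
    ; _∙_ = _∙_
    ; ε = ε
    ; _⁻¹ = _⁻¹
    ; isGroup = record
      { isMonoid = record
        { isSemigroup = record
          { isMagma = record
            { isEquivalence = record
              { refl = id , id
              ; sym = λ (p , q) → q , p
              ; trans = λ (p , q) (p′ , q′) → (λ t → p′ (p t)) , (λ t → q (q′ t))
              }
            ; ∙-cong = λ {x} {x′} {y} {y′} x~x′ y~y′ →
                let (h , h∈N , x′≈xh) = ~-elim x~x′
                    (k , k∈N , y′≈yk) = ~-elim y~y′
                in ~-intro (product (Generated-normal′ y h∈N) k∈N) (begin
                     x′ ∙ y′                        ≈⟨ ∙-cong x′≈xh y′≈yk ⟩
                     (x ∙ h) ∙ (y ∙ k)              ≈⟨ assoc (x ∙ h) y k ⟨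
                     ((x ∙ h) ∙ y) ∙ k              ≈⟨ ∙-congʳ (assoc x h y) ⟩
                     (x ∙ (h ∙ y)) ∙ k              ≈⟨ ∙-congʳ (∙-congˡ (\\-leftDividesˡ y (h ∙ y))) ⟨
                     (x ∙ (y ∙ (y ⁻¹ ∙ (h ∙ y)))) ∙ k ≈⟨ ∙-congʳ (assoc x y _) ⟨
                     ((x ∙ y) ∙ (y ⁻¹ ∙ (h ∙ y))) ∙ k ≈⟨ assoc (x ∙ y) _ k ⟩
                     (x ∙ y) ∙ (y ⁻¹ ∙ (h ∙ y) ∙ k) ∎)
            }
          ; assoc = λ x y z → ≈⇒~ (assoc x y z)
          }
        ; identity = (λ x → ≈⇒~ (identityˡ x)) , (λ x → ≈⇒~ (identityʳ x))
        }
      ; inverse = (λ x → ≈⇒~ (inverseˡ x)) , (λ x → ≈⇒~ (inverseʳ x))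
      ; ⁻¹-cong = λ {x} {y} x~y →
          let (h , h∈N , y≈xh) = ~-elim x~y in ~-intro (Generated-normal x (inverse h∈N)) (begin
            y ⁻¹                          ≈⟨ ⁻¹-cong y≈xh ⟩
            (x ∙ h) ⁻¹                    ≈⟨ ⁻¹-anti-homo-∙ x h ⟩
            h ⁻¹ ∙ x ⁻¹                   ≈⟨ \\-leftDividesʳ x _ ⟨
            x ⁻¹ ∙ (x ∙ (h ⁻¹ ∙ x ⁻¹))    ≈⟨ ∙-congˡ (assoc x (h ⁻¹) (x ⁻¹)) ⟨
            x ⁻¹ ∙ ((x ∙ h ⁻¹) ∙ x ⁻¹)    ∎)
      }
    }

module _ {ℓ} {L : Language ℓ} {N : Structure L} {κ : Set ℓ} where

  -- The conjugate fixes the image of the submodel under `g`, given here by the same structure with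
  -- `g` composed into its embedding.
  FixesSmallSubmodel-normal : ∀ (g : Automorphism N) {σ} → σ ∈ FixesSmallSubmodel N κ →
                              (g ∘ᴬ σ) ∘ᴬ invᴬ g ∈ FixesSmallSubmodel N κ
  FixesSmallSubmodel-normal g {σ} (M , fixed) =
    record
      { model = model
      ; model≼ = record
        { incl = to g ∘ incl
        ; elementary = λ φ v → ⇔.trans (elementary φ v)
            (subst (λ w → Sat N φ (map incl v) ⇔ Sat N φ w) (sym (map-∘ (to g) incl v))
              (Sat-to g φ (map incl v)))
        }
      ; small = small
      } ,
    λ x → cong (to g) (trans (cong (to σ) (strictlyInverseʳ g (incl x))) (fixed x))
    where open SmallSubmodel M

  galoisGroup : Group ℓ _
  galoisGroup = quotient (Aut N) (λ g {σ} → FixesSmallSubmodel-normal g {σ})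

  module _ (M : SmallSubmodel N κ) where
    open SmallSubmodel M

    -- `σ⁻¹τ` fixes `M` pointwise and is thus a generator.
    agree⇒~ : ∀ σ τ → to σ ∘ incl ≗ to τ ∘ incl → Group._≈_ galoisGroup σ τ
    agree⇒~ σ τ agree = ~-intro (Aut N) (λ g {σ} → FixesSmallSubmodel-normal g {σ})
      {σ} {τ} {invᴬ σ ∘ᴬ τ}
      (generator (M , λ x → trans (cong (from σ) (sym (agree x))) (strictlyInverseʳ σ _)))
      (λ x → sym (strictlyInverseˡ σ (to τ x)))

    translate : ∀ (m̄ : Enumeration model) → Automorphism N → Realization M m̄
    translate m̄ σ = record
      { tuple = to σ ∘ incl ∘ Enumeration.tuple m̄
      ; conjugate = λ φ v → ⇔.sym
          (subst (λ w → Sat N φ (map (incl ∘ Enumeration.tuple m̄) v) ⇔ Sat N φ w)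
            (sym (map-∘ (to σ) (incl ∘ Enumeration.tuple m̄) v))
            (Sat-to σ φ (map (incl ∘ Enumeration.tuple m̄) v)))
      }

module Homogeneity (em : ∀ a → ExcludedMiddle a) (ext : ∀ a b → Extensionality a b)
                   {ℓ} {L : Language ℓ} where
  open Classical em ext
  open Saturation em ext {L = L}

  module _ (N : Structure L) {Z : Set ℓ} {a b : Z → ∣ N ∣} (a⊆b : ∀ θ → Holds N a θ → Holds N b θ) where

    Holds-⊆-sym : ∀ θ → Holds N b θ → Holds N a θ
    Holds-⊆-sym θ bθ = ¬¬-elim λ ¬aθ →
      ⇒ (Holds-negation N b θ) (a⊆b (negation θ) (⇐ (Holds-negation N a θ) ¬aθ)) bθ

    automorphism : ∀ {κ} → IsStronglyHomogeneous N κ → Z <ᶜ κ →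
                   Σ[ σ ∈ Automorphism N ] to σ ∘ a ≗ b
    automorphism hom Z<κ = hom Z Z<κ a b λ φ v → mk⇔ (a⊆b (_ , φ , v)) (Holds-⊆-sym (_ , φ , v))

quotient-map : ∀ {ℓ e o n} (G : Group ℓ e) (IsOpen : Pred (Group.Carrier G) ℓ → Set o)
               (N : Pred (Group.Carrier G) n) →
               let T = record { rawGroup = Group.rawGroup G ; IsOpen = IsOpen } in
               IsContinuousEpimorphism T (T / N) id
quotient-map G IsOpen N = record
  { homomorphism = record
    { isMonoidHomomorphism = record
      { isMagmaHomomorphism = record
        { isRelHomomorphism = record { cong = coset-cong }
        ; homo = λ _ _ → id , id
        }
      ; ε-homo = id , id
      }
    ; ⁻¹-homo = λ _ → id , id
    }
  ; surjective = λ y → y , coset-cong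
  ; continuous = λ _ → proj₂
  }
  where
  module G = Group G
  coset-cong : ∀ {x y} → x G.≈ y → LeftCoset G.rawGroup x N ≐ LeftCoset G.rawGroup y N
  coset-cong x≈y =
    (λ (h , h∈N , z≈xh) → h , h∈N , G.trans z≈xh (G.∙-congʳ x≈y)) ,
    (λ (h , h∈N , z≈yh) → h , h∈N , G.trans z≈yh (G.∙-congʳ (G.sym x≈y)))

-- Dynamics of Aut(ℭ) on the type space

module Dynamics (em : ∀ a → ExcludedMiddle a) (ext : ∀ a b → Extensionality a b)
                {ℓ} {L : Language ℓ} {T : Theory L} (P : MonsterPair T)
                (c̄ : Enumeration (MonsterPair.ℭ P)) where
  open Classical em ext
  open Saturation em ext {L = L}
  open Homogeneity em ext {L = L}
  open MonsterPair P
  open _≼_ ℭ≼ℭ′ renaming (incl to ι)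
  open IsMonster ℭ′-monster
  open Enumeration c̄ using (Index; surjective) renaming (tuple to c)
  open Ellis P c̄
  open Space S using (_∋_; _∋*_) renaming (Carrier to Point; _≈_ to _≈ₛ_)
  open Group (galoisGroup {N = ℭ′} {κ = κ′}) using () renaming
    (_≈_ to _~_; refl to ~-refl; sym to ~-sym; trans to ~-trans; ∙-cong to ~-∙-cong; ⁻¹-cong to ~-⁻¹-cong)

  -- tp(σ(c̄)/ℭ)
  point : Automorphism ℭ′ → Point
  point = translate ℭ-submodel c̄

  Sub : Set ℓ
  Sub = Space.Sub S

  -- The formula θ(x̄, b) with x̄ enumerating ℭ without the repetitions in c̄.
  index : OpenFormula L (∣ ℭ ∣ ⊎ ∣ ℭ ∣) → Sub
  index = substitute (map₁ (proj₁ ∘ surjective))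

  point-index : ∀ σ θ → point σ ∋ index θ ⇔ Holds ℭ′ [ to σ ∘ ι , ι ] θ
  point-index σ θ = ⇔.trans (Holds-substitute ℭ′ (map₁ (proj₁ ∘ surjective)) [ to σ ∘ ι ∘ c , ι ] θ)
    (mk⇔ (Holds-cong ℭ′ eq θ) (Holds-cong ℭ′ (sym ∘ eq) θ))
    where
    eq : ∀ x → [ to σ ∘ ι ∘ c , ι ] (map₁ (proj₁ ∘ surjective) x) ≡ [ to σ ∘ ι , ι ] x
    eq (inj₁ b) = cong (to σ ∘ ι) (proj₂ (surjective b))
    eq (inj₂ _) = refl

  autOf : Point → Automorphism ℭ′
  autOf = typeToAut ℭ-submodel c̄ stronglyHomogeneous

  autOf-tuple : ∀ a i → to (autOf a) (ι (c i)) ≡ Realization.tuple a i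
  autOf-tuple a = proj₂ (realizingAutomorphism ℭ-submodel c̄ stronglyHomogeneous a)

  point-autOf : ∀ a → point (autOf a) ≈ₛ a
  point-autOf a θ = mk⇔ (Holds-cong ℭ′ eq θ) (Holds-cong ℭ′ (sym ∘ eq) θ)
    where
    eq : ∀ x → [ to (autOf a) ∘ ι ∘ c , ι ] x ≡ [ Realization.tuple a , ι ] x
    eq (inj₁ i) = autOf-tuple a i
    eq (inj₂ _) = refl

  ℭ⊎ℭ-small : (∣ ℭ ∣ ⊎ ∣ ℭ ∣) <ᶜ κ′
  ℭ⊎ℭ-small = ⊎-<ᶜ strongLimit ℭ-small ℭ-small

  ~-∘ᴬ-congˡ : ∀ α {ρ τ} → ρ ~ τ → (α ∘ᴬ ρ) ~ (α ∘ᴬ τ)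
  ~-∘ᴬ-congˡ α {ρ} {τ} p = ~-∙-cong {α} {α} {ρ} {τ} (~-refl {α}) p

  -- Homogeneity gives `α` that fixes ℭ pointwise and makes `αρ` agree with `τ` on ℭ. As ℭ is a
  -- small model, `α` is trivial in the Galois group.
  point⊆⇒~ : ∀ ρ τ → (∀ θ → point ρ ∋ θ → point τ ∋ θ) → ρ ~ τ
  point⊆⇒~ ρ τ ρ⊆τ with automorphism ℭ′ {a = [ to ρ ∘ ι , ι ]} {b = [ to τ ∘ ι , ι ]}
      (λ θ → ⇒ (point-index τ θ) ∘ ρ⊆τ (index θ) ∘ ⇐ (point-index ρ θ)) stronglyHomogeneous ℭ⊎ℭ-small
  ... | α , α-maps = ~-trans {ρ} {α ∘ᴬ ρ} {τ}
      (~-∙-cong {idᴬ} {α} {ρ} {ρ} (agree⇒~ ℭ-submodel idᴬ α (sym ∘ α-maps ∘ inj₂)) (~-refl {ρ}))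
      (agree⇒~ ℭ-submodel (α ∘ᴬ ρ) τ (α-maps ∘ inj₁))

  autOf-unique : ∀ ρ a → (∀ θ → a ∋ θ → point ρ ∋ θ) → ρ ~ autOf a
  autOf-unique ρ a a⊆ρ = ~-sym {autOf a} {ρ}
    (point⊆⇒~ (autOf a) ρ (λ θ → a⊆ρ θ ∘ ⇒ (point-autOf a θ)))

  autOf-cong : ∀ {a b} → a ≈ₛ b → autOf a ~ autOf b
  autOf-cong {a} {b} a≈b =
    autOf-unique (autOf a) b (λ θ → ⇐ (point-autOf a θ) ∘ ⇐ (a≈b θ))

  -- Limits of pairs of automorphisms

  module _ {K : Set ℓ} (K-small : K <ᶜ κ′) (k̄ : K → ∣ ℭ′ ∣)
           (j : ∣ ℭ ∣ → K) (k̄∘j≗ι : k̄ ∘ j ≗ ι)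
           (Γ₁ Γ₂ : Sub → Set ℓ) (Φ : OpenFormula L (K ⊎ K) → Set ℓ) where
    private
      Z : Set ℓ
      Z = ∣ ℭ ∣ ⊎ (K ⊎ K)

      left right : Index ⊎ ∣ ℭ ∣ → Z
      left  = [ inj₂ ∘ inj₁ ∘ j ∘ c , inj₁ ]
      right = [ inj₂ ∘ inj₂ ∘ j ∘ c , inj₁ ]

      -- The elements of ℭ enter as variables with their complete type, so that `realize` needs no
      -- parameters. Afterwards `α` in `fromRealization` moves their realization back to ℭ. The
      -- types of the two copies of `k̄` ensure that these are images under automorphisms.
      data Constraint : OpenFormula L Z → Set ℓ where
        type₀ : ∀ θ → Holds ℭ′ ι θ → Constraint (substitute inj₁ θ)
        type₁ : ∀ θ → Holds ℭ′ k̄ θ → Constraint (substitute (inj₂ ∘ inj₁) θ)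
        type₂ : ∀ θ → Holds ℭ′ k̄ θ → Constraint (substitute (inj₂ ∘ inj₂) θ)
        over₁ : ∀ θ → Γ₁ θ → Constraint (substitute left θ)
        over₂ : ∀ θ → Γ₂ θ → Constraint (substitute right θ)
        joint : ∀ θ → Φ θ → Constraint (substitute inj₂ θ)

      env : Automorphism ℭ′ → Automorphism ℭ′ → Z → ∣ ℭ′ ∣
      env ρ τ = [ ι , [ to ρ ∘ k̄ , to τ ∘ k̄ ] ]

      env-left : ∀ ρ τ → [ to ρ ∘ ι ∘ c , ι ] ≗ env ρ τ ∘ left
      env-left ρ τ (inj₁ i) = cong (to ρ) (sym (k̄∘j≗ι (c i)))
      env-left ρ τ (inj₂ _) = refl

      env-right : ∀ ρ τ → [ to τ ∘ ι ∘ c , ι ] ≗ env ρ τ ∘ right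
      env-right ρ τ (inj₁ i) = cong (to τ) (sym (k̄∘j≗ι (c i)))
      env-right ρ τ (inj₂ _) = refl

      -- The first three kinds of constraint hold for every pair of automorphisms, so only finite
      -- parts of `Γ₁`, `Γ₂` and `Φ` remain to be met.
      split : ∀ θs → All Constraint θs → Σ[ js ∈ List Sub ] Σ[ ks ∈ List Sub ]
        Σ[ φs ∈ List (OpenFormula L (K ⊎ K)) ] All Γ₁ js × All Γ₂ ks × All Φ φs ×
        (∀ ρ τ → point ρ ∋* js → point τ ∋* ks → All (Holds ℭ′ [ to ρ ∘ k̄ , to τ ∘ k̄ ]) φs →
         All (Holds ℭ′ (env ρ τ)) θs)
      split [] [] = [] , [] , [] , [] , [] , [] , λ _ _ _ _ _ → []
      split (_ ∷ θs) (γ ∷ γs) with split θs γs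
      split (_ ∷ θs) (type₀ θ h ∷ γs) | js , ks , φs , hjs , hks , hφs , k =
        js , ks , φs , hjs , hks , hφs , λ ρ τ p q r →
          ⇐ (Holds-substitute ℭ′ inj₁ (env ρ τ) θ) h ∷ k ρ τ p q r
      split (_ ∷ θs) (type₁ θ h ∷ γs) | js , ks , φs , hjs , hks , hφs , k =
        js , ks , φs , hjs , hks , hφs , λ ρ τ p q r →
          ⇐ (Holds-substitute ℭ′ (inj₂ ∘ inj₁) (env ρ τ) θ) (⇒ (Holds-to ℭ′ ρ k̄ θ) h) ∷ k ρ τ p q r
      split (_ ∷ θs) (type₂ θ h ∷ γs) | js , ks , φs , hjs , hks , hφs , k =
        js , ks , φs , hjs , hks , hφs , λ ρ τ p q r →
          ⇐ (Holds-substitute ℭ′ (inj₂ ∘ inj₂) (env ρ τ) θ) (⇒ (Holds-to ℭ′ τ k̄ θ) h) ∷ k ρ τ p q r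
      split (_ ∷ θs) (over₁ θ h ∷ γs) | js , ks , φs , hjs , hks , hφs , k =
        θ ∷ js , ks , φs , h ∷ hjs , hks , hφs , λ { ρ τ (p ∷ ps) q r →
          ⇐ (Holds-substitute ℭ′ left (env ρ τ) θ) (Holds-cong ℭ′ (env-left ρ τ) θ p) ∷ k ρ τ ps q r }
      split (_ ∷ θs) (over₂ θ h ∷ γs) | js , ks , φs , hjs , hks , hφs , k =
        js , θ ∷ ks , φs , hjs , h ∷ hks , hφs , λ { ρ τ p (q ∷ qs) r →
          ⇐ (Holds-substitute ℭ′ right (env ρ τ) θ) (Holds-cong ℭ′ (env-right ρ τ) θ q) ∷ k ρ τ p qs r }
      split (_ ∷ θs) (joint θ h ∷ γs) | js , ks , φs , hjs , hks , hφs , k =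
        js , ks , θ ∷ φs , hjs , hks , h ∷ hφs , λ { ρ τ p q (r ∷ rs) →
          ⇐ (Holds-substitute ℭ′ inj₂ (env ρ τ) θ) r ∷ k ρ τ p q rs }

    Limit : Set ℓ
    Limit = ∃₂ λ ρ τ → (∀ θ → Γ₁ θ → point ρ ∋ θ) × (∀ θ → Γ₂ θ → point τ ∋ θ) ×
                       (∀ φ → Φ φ → Holds ℭ′ [ to ρ ∘ k̄ , to τ ∘ k̄ ] φ)

    private
      fromRealization : ∃[ x ] Constraint ⊆ Holds ℭ′ x → Limit
      fromRealization (x , x⊨) = α ∘ᴬ ρ₀ , α ∘ᴬ τ₀ ,
        (λ θ h → Holds-cong ℭ′ (λ { (inj₁ i) → trans (moves₁ (j (c i))) (cong (to (α ∘ᴬ ρ₀)) (k̄∘j≗ι (c i)))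
                                  ; (inj₂ b) → moves₀ b }) θ (moved left θ (over₁ θ h))) ,
        (λ θ h → Holds-cong ℭ′ (λ { (inj₁ i) → trans (moves₂ (j (c i))) (cong (to (α ∘ᴬ τ₀)) (k̄∘j≗ι (c i)))
                                  ; (inj₂ b) → moves₀ b }) θ (moved right θ (over₂ θ h))) ,
        (λ φ h → Holds-cong ℭ′ (λ { (inj₁ b) → moves₁ b ; (inj₂ b) → moves₂ b }) φ
                   (moved inj₂ φ (joint φ h)))
        where
        homogeneous : ∀ {Y : Set ℓ} (f : Y → Z) {y : Y → ∣ ℭ′ ∣} → Y <ᶜ κ′ →
          (∀ θ → Holds ℭ′ y θ → Constraint (substitute f θ)) → Σ[ σ ∈ Automorphism ℭ′ ] to σ ∘ y ≗ x ∘ f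
        homogeneous f Y-small toConstraint =
          automorphism ℭ′ (λ θ h → ⇒ (Holds-substitute ℭ′ f x θ) (x⊨ (toConstraint θ h)))
            stronglyHomogeneous Y-small

        α₀ = homogeneous inj₁ ℭ-small type₀
        α = invᴬ (proj₁ α₀)
        ρ = homogeneous (inj₂ ∘ inj₁) K-small type₁
        τ = homogeneous (inj₂ ∘ inj₂) K-small type₂
        ρ₀ = proj₁ ρ
        τ₀ = proj₁ τ

        moves₀ : ∀ b → to α (x (inj₁ b)) ≡ ι b
        moves₀ b = trans (cong (to α) (sym (proj₂ α₀ b))) (strictlyInverseʳ (proj₁ α₀) (ι b))

        moves₁ : ∀ b → to α (x (inj₂ (inj₁ b))) ≡ to (α ∘ᴬ ρ₀) (k̄ b)
        moves₁ b = cong (to α) (sym (proj₂ ρ b))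

        moves₂ : ∀ b → to α (x (inj₂ (inj₂ b))) ≡ to (α ∘ᴬ τ₀) (k̄ b)
        moves₂ b = cong (to α) (sym (proj₂ τ b))

        moved : ∀ {Y : Set ℓ} (f : Y → Z) θ → Constraint (substitute f θ) → Holds ℭ′ (to α ∘ x ∘ f) θ
        moved f θ h = ⇒ (Holds-to ℭ′ α (x ∘ f) θ) (⇒ (Holds-substitute ℭ′ f x θ) (x⊨ h))

    abstract
      limitPair : (∀ {js ks φs} → All Γ₁ js → All Γ₂ ks → All Φ φs →
        ∃₂ λ ρ τ → point ρ ∋* js × point τ ∋* ks × All (Holds ℭ′ [ to ρ ∘ k̄ , to τ ∘ k̄ ]) φs) → Limit
      limitPair approximate = fromRealization (realize ℭ′ saturated
          (⊎-<ᶜ strongLimit ℭ-small (⊎-<ᶜ strongLimit K-small K-small)) Constraint λ θs γs →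
            let (_ , _ , _ , hjs , hks , hφs , k) = split θs γs
                (ρ , τ , p , q , r) = approximate hjs hks hφs
            in env ρ τ , k ρ τ p q r)

  base : Point
  base = basePoint ℭ-submodel c̄

  lifting : Automorphism ℭ → Automorphism ℭ′
  lifting g = proj₁ (extension g)

  act∋⇒point∋ : ∀ g a θ → act g a ∋ θ → point (lifting g ∘ᴬ autOf a) ∋ θ
  act∋⇒point∋ g a θ = ⇐ (Func.cong (actMap g) {point (autOf a)} {a} (point-autOf a) θ)

  -- The joint formulas have no further parameters, so applying one automorphism to both tuples
  -- preserves them.
  Holds-lifting : ∀ {K : Set ℓ} (k̄ : K → ∣ ℭ′ ∣) ρ τ g {φs} →
                  All (Holds ℭ′ [ to ρ ∘ k̄ , to τ ∘ k̄ ]) φs →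
                  All (Holds ℭ′ [ to (lifting g ∘ᴬ ρ) ∘ k̄ , to (lifting g ∘ᴬ τ) ∘ k̄ ]) φs
  Holds-lifting k̄ ρ τ g = All.map λ {φ} h → Holds-cong ℭ′ (λ { (inj₁ _) → refl ; (inj₂ _) → refl }) φ
    (⇒ (Holds-to ℭ′ (lifting g) [ to ρ ∘ k̄ , to τ ∘ k̄ ] φ) h)

  -- A basic open set of the product may restrict several coordinates, hence a single `g` serves
  -- both points.
  approximate₂ : ∀ x {a b js ks} → (fn x ⟨$⟩ a) ∋* js → (fn x ⟨$⟩ b) ∋* ks →
                 ∃[ g ] act g a ∋* js × act g b ∋* ks
  approximate₂ x {a} {b} {js} {ks} p q =
    let (g , h) = approximate x {mapᴸ (a ,_) js ++ mapᴸ (b ,_) ks} (++⁺ (All.map⁺ p) (All.map⁺ q))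
        (h₁ , h₂) = ++⁻ (mapᴸ (a ,_) js) h
    in g , All.map⁻ h₁ , All.map⁻ h₂

  -- f̂(x) determines how x acts on every point, not only on tp(c̄/ℭ).
  autOf-act : ∀ x a → autOf (fn x ⟨$⟩ a) ~ (f̂ x ∘ᴬ autOf a)
  autOf-act x a = conclude (limitPair ℭ-small ι id (λ _ → refl)
      ((fn x ⟨$⟩ a) ∋_) ((fn x ⟨$⟩ base) ∋_) (Holds ℭ′ [ to (autOf a) ∘ ι , ι ]) λ {js} {ks} p q r →
        let (g , hjs , hks) = approximate₂ x p q in
        lifting g ∘ᴬ autOf a , lifting g , All.map (λ {θ} → act∋⇒point∋ g a θ) hjs , hks ,
        Holds-lifting ι (autOf a) idᴬ g r)
    where
    conclude : Limit ℭ-small ι id (λ _ → refl)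
      ((fn x ⟨$⟩ a) ∋_) ((fn x ⟨$⟩ base) ∋_) (Holds ℭ′ [ to (autOf a) ∘ ι , ι ]) →
      autOf (fn x ⟨$⟩ a) ~ (f̂ x ∘ᴬ autOf a)
    -- On ℭ, the pair `(ρ, τ)` has the same type as `(autOf a, id)`. So `α` agrees on ℭ with `τ`,
    -- which represents `f̂ x`, and `α ∘ᴬ autOf a` agrees there with `ρ`.
    conclude (ρ , τ , hρ , hτ , h) with automorphism ℭ′ h stronglyHomogeneous ℭ⊎ℭ-small
    ... | α , α-maps =
      ~-trans {autOf (fn x ⟨$⟩ a)} {ρ} {f̂ x ∘ᴬ autOf a}
        (~-sym {ρ} {autOf (fn x ⟨$⟩ a)} (autOf-unique ρ (fn x ⟨$⟩ a) hρ))
        (~-trans {ρ} {α ∘ᴬ autOf a} {f̂ x ∘ᴬ autOf a}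
          (agree⇒~ ℭ-submodel ρ (α ∘ᴬ autOf a) (sym ∘ α-maps ∘ inj₁))
          (~-∙-cong {α} {f̂ x} {autOf a} {autOf a}
            (~-trans {α} {τ} {f̂ x} (agree⇒~ ℭ-submodel α τ (α-maps ∘ inj₂))
              (autOf-unique τ (fn x ⟨$⟩ base) hτ))
            (~-refl {autOf a})))

  -- These formulas take over the role of the neighbourhoods of 1, which do not
  -- separate points as Gal_L(T) need not be Hausdorff.
  Thick : OpenFormula L (∣ ℭ ∣ ⊎ ∣ ℭ ∣) → Set ℓ
  Thick ψ = ∀ ρ τ → point ρ ≈ₛ point τ → Holds ℭ′ [ to ρ ∘ ι , to τ ∘ ι ] ψ

  -- Thick formulas and equality in the Galois group

  module _ (ρ τ : Automorphism ℭ′) (thick : ∀ ψ → Thick ψ → Holds ℭ′ [ to ρ ∘ ι , to τ ∘ ι ] ψ) where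
    private
      X Z : Set ℓ
      X = ∣ ℭ ∣ ⊎ ∣ ℭ ∣
      Z = X ⊎ ∣ ℭ ∣

      left right : X → Z
      left  = [ inj₁ ∘ inj₁ , inj₂ ]
      right = [ inj₁ ∘ inj₂ , inj₂ ]

      -- A realization consists of a copy of the pair `(ρ, τ)` on ℭ and a copy of ℭ, whose position
      -- relative to each other is restricted only by `same`: both halves of the pair have the same
      -- type over the copy of ℭ.
      data Constraint : OpenFormula L Z → Set ℓ where
        pair  : ∀ χ → Holds ℭ′ [ to ρ ∘ ι , to τ ∘ ι ] χ → Constraint (substitute inj₁ χ)
        model : ∀ θ → Holds ℭ′ ι θ → Constraint (substitute inj₂ θ)
        same  : ∀ φ → Constraint (implication (substitute left φ) (substitute right φ))

      env : Automorphism ℭ′ → Automorphism ℭ′ → Z → ∣ ℭ′ ∣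
      env ρ′ τ′ = [ [ to ρ′ ∘ ι , to τ′ ∘ ι ] , ι ]

      split : ∀ θs → All Constraint θs → Σ[ χs ∈ List (OpenFormula L X) ]
        All (Holds ℭ′ [ to ρ ∘ ι , to τ ∘ ι ]) χs ×
        (∀ ρ′ τ′ → point ρ′ ≈ₛ point τ′ → All (Holds ℭ′ [ to ρ′ ∘ ι , to τ′ ∘ ι ]) χs →
         All (Holds ℭ′ (env ρ′ τ′)) θs)
      split [] [] = [] , [] , λ _ _ _ _ → []
      split (_ ∷ θs) (γ ∷ γs) with split θs γs
      split (_ ∷ θs) (pair χ h ∷ γs)  | χs , hs , k = χ ∷ χs , h ∷ hs , λ { ρ′ τ′ p (t ∷ ts) →
        ⇐ (Holds-substitute ℭ′ inj₁ (env ρ′ τ′) χ) t ∷ k ρ′ τ′ p ts }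
      split (_ ∷ θs) (model θ h ∷ γs) | χs , hs , k = χs , hs , λ ρ′ τ′ p ts →
        ⇐ (Holds-substitute ℭ′ inj₂ (env ρ′ τ′) θ) h ∷ k ρ′ τ′ p ts
      split (_ ∷ θs) (same φ ∷ γs)    | χs , hs , k = χs , hs , λ ρ′ τ′ p ts →
        ⇐ (Holds-implication ℭ′ (env ρ′ τ′) (substitute left φ) (substitute right φ))
          (λ h → ⇐ (Holds-substitute ℭ′ right (env ρ′ τ′) φ)
            (Holds-cong ℭ′ (λ { (inj₁ _) → refl ; (inj₂ _) → refl }) φ
              (⇒ (point-index τ′ φ) (⇒ (p (index φ)) (⇐ (point-index ρ′ φ)
                (Holds-cong ℭ′ (λ { (inj₁ _) → refl ; (inj₂ _) → refl }) φ
                  (⇒ (Holds-substitute ℭ′ left (env ρ′ τ′) φ) h)))))))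
        ∷ k ρ′ τ′ p ts

      -- Otherwise the negation of the conjunction of χs is thick.
      satisfiable : ∀ χs → All (Holds ℭ′ [ to ρ ∘ ι , to τ ∘ ι ]) χs →
        ∃₂ λ ρ′ τ′ → point ρ′ ≈ₛ point τ′ × All (Holds ℭ′ [ to ρ′ ∘ ι , to τ′ ∘ ι ]) χs
      satisfiable χs hs = ¬¬-elim λ none →
        ⇒ (Holds-negation ℭ′ [ to ρ ∘ ι , to τ ∘ ι ] (conjunction χs))
          (thick (negation (conjunction χs)) λ ρ′ τ′ p →
            ⇐ (Holds-negation ℭ′ [ to ρ′ ∘ ι , to τ′ ∘ ι ] (conjunction χs)) λ h →
              none (ρ′ , τ′ , p , ⇒ (Holds-conjunction ℭ′ [ to ρ′ ∘ ι , to τ′ ∘ ι ] χs) h))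
          (⇐ (Holds-conjunction ℭ′ [ to ρ ∘ ι , to τ ∘ ι ] χs) hs)

      fromRealization : ∃[ x ] Constraint ⊆ Holds ℭ′ x → ρ ~ τ
      fromRealization (x , x⊨)
        with automorphism ℭ′ {a = [ to ρ ∘ ι , to τ ∘ ι ]} {b = x ∘ inj₁}
               (λ χ h → ⇒ (Holds-substitute ℭ′ inj₁ x χ) (x⊨ (pair χ h))) stronglyHomogeneous ℭ⊎ℭ-small
           | automorphism ℭ′ {a = ι} {b = x ∘ inj₂}
               (λ θ h → ⇒ (Holds-substitute ℭ′ inj₂ x θ) (x⊨ (model θ h))) stronglyHomogeneous ℭ-small
      ... | α , α-maps | β , β-maps = ~-trans {ρ} {βα⁻¹ ∘ᴬ (αβ ∘ᴬ ρ)} {τ}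
              (agree⇒~ ℭ-submodel ρ (βα⁻¹ ∘ᴬ (αβ ∘ᴬ ρ)) (sym ∘ cancel ρ))
              (~-trans {βα⁻¹ ∘ᴬ (αβ ∘ᴬ ρ)} {βα⁻¹ ∘ᴬ (αβ ∘ᴬ τ)} {τ}
                (~-∘ᴬ-congˡ βα⁻¹ {αβ ∘ᴬ ρ} {αβ ∘ᴬ τ} (point⊆⇒~ (αβ ∘ᴬ ρ) (αβ ∘ᴬ τ) transfer))
                (agree⇒~ ℭ-submodel (βα⁻¹ ∘ᴬ (αβ ∘ᴬ τ)) τ (cancel τ)))
        where
        αβ βα⁻¹ : Automorphism ℭ′
        αβ = invᴬ β ∘ᴬ α
        βα⁻¹ = invᴬ α ∘ᴬ β

        cancel : ∀ σ b → to (βα⁻¹ ∘ᴬ (αβ ∘ᴬ σ)) (ι b) ≡ to σ (ι b)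
        cancel σ b = trans (cong (from α) (strictlyInverseˡ β _)) (strictlyInverseʳ α _)

        moved : ∀ (f : X → Z) σ → (∀ y → x (f y) ≡ [ to α ∘ to σ ∘ ι , to β ∘ ι ] y) →
                ∀ φ → Holds ℭ′ x (substitute f φ) ⇔ Holds ℭ′ [ to (αβ ∘ᴬ σ) ∘ ι , ι ] φ
        moved f σ eq φ = ⇔.trans (Holds-substitute ℭ′ f x φ) (⇔.trans (Holds-to ℭ′ (invᴬ β) (x ∘ f) φ)
          (mk⇔ (Holds-cong ℭ′ eq′ φ) (Holds-cong ℭ′ (sym ∘ eq′) φ)))
          where
          eq′ : ∀ y → from β (x (f y)) ≡ [ to (αβ ∘ᴬ σ) ∘ ι , ι ] y
          eq′ (inj₁ b) = cong (from β) (eq (inj₁ b))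
          eq′ (inj₂ b) = trans (cong (from β) (eq (inj₂ b))) (strictlyInverseʳ β (ι b))

        left-eq : ∀ y → x (left y) ≡ [ to α ∘ to ρ ∘ ι , to β ∘ ι ] y
        left-eq (inj₁ b) = sym (α-maps (inj₁ b))
        left-eq (inj₂ b) = sym (β-maps b)

        right-eq : ∀ y → x (right y) ≡ [ to α ∘ to τ ∘ ι , to β ∘ ι ] y
        right-eq (inj₁ b) = sym (α-maps (inj₂ b))
        right-eq (inj₂ b) = sym (β-maps b)

        unindexed : ∀ σ θ → point σ ∋ θ ⇔ Holds ℭ′ [ to σ ∘ ι , ι ] (substitute (map₁ c) θ)
        unindexed σ θ = ⇔.sym (⇔.trans (Holds-substitute ℭ′ (map₁ c) [ to σ ∘ ι , ι ] θ)
          (mk⇔ (Holds-cong ℭ′ eq θ) (Holds-cong ℭ′ (sym ∘ eq) θ)))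
          where
          eq : ∀ y → [ to σ ∘ ι , ι ] (map₁ c y) ≡ [ to σ ∘ ι ∘ c , ι ] y
          eq (inj₁ _) = refl
          eq (inj₂ _) = refl

        transfer : ∀ θ → point (αβ ∘ᴬ ρ) ∋ θ → point (αβ ∘ᴬ τ) ∋ θ
        transfer θ h = ⇐ (unindexed (αβ ∘ᴬ τ) θ) (⇒ (moved right τ right-eq φ)
          (⇒ (Holds-implication ℭ′ x (substitute left φ) (substitute right φ)) (x⊨ (same φ))
            (⇐ (moved left ρ left-eq φ) (⇒ (unindexed (αβ ∘ᴬ ρ) θ) h))))
          where φ = substitute (map₁ c) θ

    -- Tuples with the same type over some small model are conjugate under the Lascar group. Here
    -- the model is a copy of ℭ, and `β⁻¹α` carries the situation back to ℭ, where `point⊆⇒~`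
    -- applies.
    thick⇒~ : ρ ~ τ
    thick⇒~ = fromRealization (realize ℭ′ saturated (⊎-<ᶜ strongLimit ℭ⊎ℭ-small ℭ-small) Constraint λ θs γs →
      let (χs , hs , k) = split θs γs
          (ρ′ , τ′ , p , ts) = satisfiable χs hs
      in env ρ′ τ′ , k ρ′ τ′ p ts)

  -- Density of the orbit and surjectivity of `f̂`

  compactness : (Γ : Sub → Set ℓ) → (∀ θs → All Γ θs → ∃[ σ ] point σ ∋* θs) →
                ∃[ σ ] (∀ θ → Γ θ → point σ ∋ θ)
  compactness Γ satisfiable =
    let (σ , _ , h , _) = limitPair ℭ-small ι id (λ _ → refl) Γ (λ _ → ⊥) (λ _ → ⊥) λ {js} p q r →
          let (σ , h) = satisfiable js p in σ , σ , h , All.map (λ ()) q , All.map (λ ()) r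
    in σ , h

  Holds-elementary : ∀ {Z : Set ℓ} (e : Z → ∣ ℭ ∣) θ → Holds ℭ e θ ⇔ Holds ℭ′ (ι ∘ e) θ
  Holds-elementary e (_ , φ , v) = subst (λ w → Sat ℭ φ (map e v) ⇔ Sat ℭ′ φ w)
    (sym (map-∘ ι e v)) (elementary φ (map e v))

  -- The existential closure of `θ` is a sentence in effect, and so passes from ℭ′ to ℭ.
  satisfiable-ℭ : ∀ {Z : Set ℓ} (x : Z → ∣ ℭ′ ∣) θ → Holds ℭ′ x θ → ∃[ y ] Holds ℭ y θ
  satisfiable-ℭ x θ h =
    let (y , h′ , _) = Holds-existsAll⁻ ℭ constant (variables θ) θ
          (⇐ (Holds-elementary constant (existsAll (variables θ) θ))
            (Holds-existsAll⁺ ℭ′ (ι ∘ constant) (variables θ) θ x h λ _ → inj₁))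
    in y , h′
    where
    constant : _ → ∣ ℭ ∣
    constant _ = Structure.nonempty ℭ

  module _ (σ : Automorphism ℭ′) {n} (φ : Formula L n) (v : Vec (Index ⊎ ∣ ℭ ∣) n)
           (σ⊨ : point σ ∋ (n , φ , v)) where
    private
      module ℭM = IsMonster ℭ-monster

      F : Set ℓ
      F = Lift ℓ (Fin n)

      F-small : F <ᶜ κ
      -- Since `falsum` is a formula in any number of variables, a finite set embeds into the set of
      -- formulas, which is smaller than κ.
      F-small = ↣-<ᶜ (mk↣ {to = λ k → toℕ (lower k) , falsum}
        λ eq → cong lift (toℕ-injective (cong proj₁ eq))) ℭM.large

      -- A position of the other kind gets a default value, to which `θ` never refers.
      indexed parameters : F → ∣ ℭ ∣
      indexed k    = [ c , (λ _ → Structure.nonempty ℭ) ] (lookup v (lower k))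
      parameters k = [ (λ _ → Structure.nonempty ℭ) , id ] (lookup v (lower k))

      tag : Fin n → Index ⊎ ∣ ℭ ∣ → F ⊎ F
      tag k = [ (λ _ → inj₁ (lift k)) , (λ _ → inj₂ (lift k)) ]

      θ : OpenFormula L (F ⊎ F)
      θ = n , φ , tabulate (λ k → tag k (lookup v k))

      map-tag : ∀ {B : Set ℓ} (x : F ⊎ F → B) e → (∀ k → x (tag k (lookup v k)) ≡ e (lookup v k)) →
                map x (proj₂ (proj₂ θ)) ≡ map e v
      map-tag x e eq = trans (sym (tabulate-∘ x _)) (trans (tabulate-cong eq)
        (trans (tabulate-∘ e (lookup v)) (cong (map e) (tabulate∘lookup v))))

      data Constraint : OpenFormula L (F ⊎ F) → Set ℓ where
        type₁ : ∀ χ → Holds ℭ indexed χ → Constraint (substitute inj₁ χ)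
        type₂ : ∀ χ → Holds ℭ parameters χ → Constraint (substitute inj₂ χ)
        main  : Constraint θ

      env : F ⊎ F → ∣ ℭ′ ∣
      env = [ to σ ∘ ι ∘ indexed , ι ∘ parameters ]

      env-tag : ∀ k z → z ≡ lookup v k → env (tag k z) ≡ [ to σ ∘ ι ∘ c , ι ] z
      env-tag k (inj₁ i) eq = cong (to σ ∘ ι ∘ [ c , _ ]) (sym eq)
      env-tag k (inj₂ b) eq = cong (ι ∘ [ (λ _ → Structure.nonempty ℭ) , id ]) (sym eq)

      env⊨ : ∀ {χ} → Constraint χ → Holds ℭ′ env χ
      env⊨ (type₁ χ h) = ⇐ (Holds-substitute ℭ′ inj₁ env χ)
        (⇒ (Holds-to ℭ′ σ (ι ∘ indexed) χ) (⇒ (Holds-elementary indexed χ) h))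
      env⊨ (type₂ χ h) = ⇐ (Holds-substitute ℭ′ inj₂ env χ) (⇒ (Holds-elementary parameters χ) h)
      env⊨ main = subst (Sat ℭ′ φ) (sym (map-tag env [ to σ ∘ ι ∘ c , ι ] λ k → env-tag k _ refl)) σ⊨

      fromRealization : ∃[ x ] Constraint ⊆ Holds ℭ x → ∃[ g ] act g base ∋ (n , φ , v)
      fromRealization (x , x⊨)
        with automorphism ℭ {a = indexed} {b = x ∘ inj₁}
               (λ χ h → ⇒ (Holds-substitute ℭ inj₁ x χ) (x⊨ (type₁ χ h))) ℭM.stronglyHomogeneous F-small
           | automorphism ℭ {a = parameters} {b = x ∘ inj₂}
               (λ χ h → ⇒ (Holds-substitute ℭ inj₂ x χ) (x⊨ (type₂ χ h))) ℭM.stronglyHomogeneous F-small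
      ... | α , α-maps | β , β-maps = g , subst (Sat ℭ′ φ)
              (map-tag (ι ∘ from β ∘ x) [ to (lifting g) ∘ ι ∘ c , ι ] λ k → eq k _ refl)
              (⇒ (Holds-elementary (from β ∘ x) θ) (⇒ (Holds-to ℭ (invᴬ β) x θ) (x⊨ main)))
        where
        g : Automorphism ℭ
        g = invᴬ β ∘ᴬ α

        eq : ∀ k z → z ≡ lookup v k → ι (from β (x (tag k z))) ≡ [ to (lifting g) ∘ ι ∘ c , ι ] z
        eq k (inj₁ i) z≡ = trans (cong (ι ∘ from β) (trans (sym (α-maps (lift k)))
          (cong (to α ∘ [ c , _ ]) (sym z≡)))) (sym (proj₂ (extension g) (c i)))
        eq k (inj₂ b) z≡ = cong ι (trans (cong (from β) (trans (sym (β-maps (lift k)))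
          (cong (to β ∘ [ (λ _ → Structure.nonempty ℭ) , id ]) (sym z≡)))) (strictlyInverseʳ β b))

    -- The finitely many entries of `c̄` and parameters in the formula have types that are jointly
    -- satisfiable with it in ℭ′, hence realized in ℭ by saturation. Homogeneity of ℭ moves the
    -- parameters back to their place, and what it does to the entries of `c̄` is the action of `g`.
    dense₁ : ∃[ g ] act g base ∋ (n , φ , v)
    dense₁ = fromRealization (realize ℭ ℭM.saturated (⊎-<ᶜ ℭM.strongLimit F-small F-small) Constraint λ χs γs →
      let (y , h) = satisfiable-ℭ env (conjunction χs)
            (⇐ (Holds-conjunction ℭ′ env χs) (All.map env⊨ γs))
      in y , ⇒ (Holds-conjunction ℭ y χs) h)

  dense : ∀ σ js → point σ ∋* js → ∃[ g ] act g base ∋* js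
  dense σ js h =
    let (_ , φ , v) = conjunction js
        (g , h′) = dense₁ σ φ v (⇐ (Holds-conjunction ℭ′ [ to σ ∘ ι ∘ c , ι ] js) h)
    in g , ⇒ (Holds-conjunction ℭ′ [ to (lifting g) ∘ ι ∘ c , ι ] js) h′

  ∋-negation : ∀ a θ → a ∋ negation θ ⇔ (¬ a ∋ θ)
  ∋-negation a = Holds-negation ℭ′ [ Realization.tuple a , ι ]

  ∋-conjunction : ∀ a θs → a ∋ conjunction θs ⇔ a ∋* θs
  ∋-conjunction a = Holds-conjunction ℭ′ [ Realization.tuple a , ι ]

  ∋-⊆⇒≈ₛ : ∀ {a b} → (∀ θ → a ∋ θ → b ∋ θ) → a ≈ₛ b
  ∋-⊆⇒≈ₛ {a} {b} a⊆b θ = mk⇔ (a⊆b θ) λ b∋θ → ¬¬-elim λ a∌θ →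
    ⇒ (∋-negation b θ) (a⊆b (negation θ) (⇐ (∋-negation a θ) a∌θ)) b∋θ

  module _ (q : Point) (q-approximated : ∀ js → q ∋* js → ∃[ g ] act g base ∋* js) where
    private
      Known : (Point → Maybe Point) → Point × Sub → Set ℓ
      Known d (a , θ) = ∃[ b ] d a ≡ just b × b ∋ θ

      Moves : Automorphism ℭ → Point × Sub → Set ℓ
      Moves g (a , θ) = act g a ∋ θ

      -- Finitely many demands are to be met by a single `g`. Those that `q` makes at `base` are
      -- listed apart, because `d` may be undefined there.
      Consistent : (Point → Maybe Point) → Set ℓ
      Consistent d = ∀ js ls → q ∋* js → All (Known d) ls → ∃[ g ] act g base ∋* js × All (Moves g) ls

      empty-consistent : Consistent (λ _ → nothing)
      empty-consistent js [] q∋ _ = let (g , h) = q-approximated js q∋ in g , h , []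
      empty-consistent js (_ ∷ _) q∋ ((_ , () , _) ∷ _)

      local : ∀ d → (∀ as → ∃[ e ] e ∈ Consistent × All (λ a → e a ≡ d a) as) → d ∈ Consistent
      local d approx js ls q∋ known with approx (mapᴸ proj₁ ls)
      ... | e , e-consistent , agree = e-consistent js ls q∋
        (All.zipWith (λ (eq , b , da , b∋) → b , trans eq da , b∋) (All.map⁻ agree , known))

      Separation : Point → Point → (Point → Maybe Point) → List (Point × Sub) → Set ℓ
      Separation a b d ls = ∃₂ λ ls′ θs →
        All (Known d) ls′ × b ∋* θs × (∀ g → All (Moves g) ls′ → act g a ∋* θs → All (Moves g) ls)

      separate : ∀ a b d ls → All (Known (update d a (just b))) ls → Separation a b d ls
      separate a b d [] [] = [] , [] , [] , [] , λ _ _ _ → []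
      separate a b d ((a′ , θ) ∷ ls) ((b′ , eq , b′∋) ∷ ks) =
        add (update-cases d eq) (separate a b d ls ks)
        where
        add : (a ≡ a′ × just b ≡ just b′) ⊎ d a′ ≡ just b′ → Separation a b d ls →
              Separation a b d ((a′ , θ) ∷ ls)
        add (inj₁ (refl , refl)) (ls′ , θs , k , h , back) =
          ls′ , θ ∷ θs , k , b′∋ ∷ h , λ { g m (n ∷ ns) → n ∷ back g m ns }
        add (inj₂ eq) (ls′ , θs , k , h , back) =
          (a′ , θ) ∷ ls′ , θs , (b′ , eq , b′∋) ∷ k , h , λ { g (m ∷ ms) n → m ∷ back g ms n }

      module Extend (d : Point → Maybe Point) (consistent : Consistent d) (a : Point) where
        -- Any point satisfying all forced formulas is a possible value at `a`: if it were
        -- inconsistent with `d`, the negation of one of its formulas would be forced.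
        Forced : Sub → Set ℓ
        Forced θ = ∃₂ λ js ls → q ∋* js × All (Known d) ls ×
                   (∀ g → act g base ∋* js → All (Moves g) ls → act g a ∋ θ)

        gather : ∀ θs → All Forced θs → ∃₂ λ js ls → q ∋* js × All (Known d) ls ×
                 (∀ g → act g base ∋* js → All (Moves g) ls → act g a ∋* θs)
        gather [] [] = [] , [] , [] , [] , λ _ _ _ → []
        gather (_ ∷ θs) ((js , ls , p , k , force) ∷ hs) =
          let (js′ , ls′ , p′ , k′ , force′) = gather θs hs in
          js ++ js′ , ls ++ ls′ , ++⁺ p p′ , ++⁺ k k′ , λ g h m →
            force g (proj₁ (++⁻ js h)) (proj₁ (++⁻ ls m)) ∷
            force′ g (proj₂ (++⁻ js h)) (proj₂ (++⁻ ls m))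

        limit : ∃[ σ ] (∀ θ → Forced θ → point σ ∋ θ)
        limit = compactness Forced λ θs hs →
          let (js , ls , p , k , force) = gather θs hs
              (g , h , m) = consistent js ls p k
          in lifting g ∘ᴬ autOf a , All.map (λ {θ} → act∋⇒point∋ g a θ) (force g h m)

        b : Point
        b = point (proj₁ limit)

        extended : Consistent (update d a (just b))
        extended js ls q∋ known =
          let (ls′ , θs , k , b∋ , back) = separate a b d ls known in ¬¬-elim λ none →
          ⇒ (∋-negation b (conjunction θs))
            (proj₂ limit (negation (conjunction θs)) (js , ls′ , q∋ , k , λ g h m →
              ⇐ (∋-negation (act g a) (conjunction θs)) λ n →
                none (g , h , back g m (⇒ (∋-conjunction (act g a) θs) n))))
            (⇐ (∋-conjunction b θs) b∋)

      fromTotal : ∃[ x ] Consistent (just ∘ x) → ∃[ x ] fn x ⟨$⟩ base ≈ₛ q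
      fromTotal (x , consistent) = mkEL func func-in-closure , λ θ → ⇔.sym (∋-⊆⇒≈ₛ {q} {x base} evaluates θ)
        where
        separated : ∀ js a a′ θ → q ∋* js → x a ∋ θ → ¬ x a′ ∋ θ →
                    ∃[ g ] act g base ∋* js × act g a ∋ θ × ¬ act g a′ ∋ θ
        separated js a a′ θ q∋ xa∋θ xa′∌θ with consistent js ((a , θ) ∷ (a′ , negation θ) ∷ []) q∋
          ((_ , refl , xa∋θ) ∷ (_ , refl , ⇐ (∋-negation (x a′) θ) xa′∌θ) ∷ [])
        ... | g , h , m ∷ m′ ∷ [] = g , h , m , ⇒ (∋-negation (act g a′) θ) m′

        func : Func (Space.setoid S) (Space.setoid S)
        func = record
          { to = x
          -- A formula separating the two values would also separate those of some `g`, but the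
          -- action of `g` respects equality of types.
          ; cong = λ {a} {a′} a≈a′ → ∋-⊆⇒≈ₛ {x a} {x a′} λ θ xa∋θ → ¬¬-elim λ xa′∌θ →
              let (g , _ , m , m′) = separated [] a a′ θ [] xa∋θ xa′∌θ
              in m′ (⇒ (Func.cong (actMap g) {a} {a′} a≈a′ θ) m)
          }

        func-in-closure : func ∈ Space.closure (selfMaps S) IsAut
        func-in-closure ls h =
          let (g , _ , m) = consistent [] ls [] (All.map (λ {l} k → x (proj₁ l) , refl , k) h)
          in actMap g , (g , λ _ _ → ⇔.refl) , m

        evaluates : ∀ θ → q ∋ θ → x base ∋ θ
        evaluates θ q∋θ = ¬¬-elim λ x∌θ → impossible (consistent (θ ∷ []) ((base , negation θ) ∷ [])
          (q∋θ ∷ []) ((_ , refl , ⇐ (∋-negation (x base) θ) x∌θ) ∷ []))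
          where
          impossible : ¬ (∃[ g ] act g base ∋* (θ ∷ []) × All (Moves g) ((base , negation θ) ∷ []))
          impossible (g , m ∷ [] , m′ ∷ []) = ⇒ (∋-negation (act g base) θ) m′ m

    -- Compactness of EL: the limit is built by adding one value after the other to a consistent
    -- partial map.
    evaluation : ∃[ x ] fn x ⟨$⟩ base ≈ₛ q
    evaluation = fromTotal (totalPartial Consistent empty-consistent local
      λ d consistent a _ → Extend.b d consistent a , Extend.extended d consistent a)

  f̂-surjective : ∀ σ → ∃[ x ] f̂ x ~ σ
  f̂-surjective σ =
    let (x , eq) = evaluation (point σ) (dense σ) in
    x , ~-trans {f̂ x} {autOf (point σ)} {σ} (autOf-cong {fn x ⟨$⟩ base} {point σ} eq)
          (~-sym {σ} {autOf (point σ)} (autOf-unique σ (point σ) λ _ → id))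

  f̂-∙ : ∀ x y → f̂ (x ∙ y) ~ (f̂ x ∘ᴬ f̂ y)
  f̂-∙ x y = autOf-act x (fn y ⟨$⟩ base)

  f̂-cong : ∀ {x y} → x ≈ y → f̂ x ~ f̂ y
  f̂-cong {x} {y} x≈y = autOf-cong {fn x ⟨$⟩ base} {fn y ⟨$⟩ base} (pointwise x≈y base)

  -- The τ-topology and the kernel of `f`

  module _ {𝓜 : Pred EL ℓ} (𝓜-minimal : IsMinimalLeftIdeal 𝓜)
           {u : EL} (u∈𝓜 : u ∈ 𝓜) (u-idempotent : u ∙ u ≈ u) where
    open EllisGroup 𝓜-minimal u∈𝓜 u-idempotent
    open IsMinimalLeftIdeal 𝓜-minimal using (absorbs)
    private
      module G = Group ellisGroup
      module Gal = Group (galoisGroup {N = ℭ′} {κ = κ′})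
      module SS = Space (selfMaps S)

    f̂-u : f̂ u ~ idᴬ
    f̂-u = GroupProperties.identityˡ-unique galoisGroup (f̂ u) (f̂ u)
      (~-trans {f̂ u ∘ᴬ f̂ u} {f̂ (u ∙ u)} {f̂ u} (~-sym {f̂ (u ∙ u)} {f̂ u ∘ᴬ f̂ u} (f̂-∙ u u)) (f̂-cong u-idempotent))

    realizes-u : ∀ τ → (∀ θ → (fn u ⟨$⟩ base) ∋ θ → point τ ∋ θ) → τ ~ idᴬ
    realizes-u τ h = ~-trans {τ} {f̂ u} {idᴬ} (autOf-unique τ (fn u ⟨$⟩ base) h) f̂-u

    -- An index beyond the thresholds of both nets meets finitely many conditions from each limit,
    -- which is the finite form that `limitPair` asks for.
    cl-τ-approximate : ∀ (A : G.Carrier → Set ℓ) p → p ∈ cl-τ A → ∀ {a js ks} →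
      (fn (proj₁ p) ⟨$⟩ base) ∋* js → (fn u ⟨$⟩ a) ∋* ks →
      ∃₂ λ g η → η ∈ A × act g (fn (proj₁ η) ⟨$⟩ base) ∋* js × act g a ∋* ks
    cl-τ-approximate A p (D , ηs , gs , ηs∈A , gs→u , gη→p) {a} {js} {ks} hp hu =
      let (i₁ , h₁) = gη→p (mapᴸ (base ,_) js) (All.map⁺ hp)
          (i₂ , h₂) = gs→u (mapᴸ (a ,_) ks) (All.map⁺ hu)
          (k , i₁≤k , i₂≤k) = directed i₁ i₂
          (η , η∈A , ηₖ≈η) = ηs∈A k
      in gs k , η , η∈A ,
         All.map (λ {θ} → ⇒ (Func.cong (actMap (gs k)) {fn (ηs k) ⟨$⟩ base} {fn (proj₁ η) ⟨$⟩ base}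
           (pointwise ηₖ≈η base) θ)) (All.map⁻ (h₁ k i₁≤k)) ,
         All.map⁻ (h₂ k i₂≤k)
      where open DirectedSet D

    cl-τ-mono : ∀ {A B : G.Carrier → Set ℓ} → (∀ p → A p → B p) → ∀ p → cl-τ A p → cl-τ B p
    cl-τ-mono A⊆B p (D , ηs , gs , ηs∈A , conv) =
      D , ηs , gs , (λ i → let (η , η∈A , eq) = ηs∈A i in η , A⊆B η η∈A , eq) , conv

    -- The net `ηs` is constantly `u`, and `gs` chooses an automorphism from each basic
    -- neighbourhood of `u`, ordered by reverse inclusion. Then `gᵢu` tends to `uu = u`.
    ε∈cl-τ : ∀ (A : G.Carrier → Set ℓ) → G.ε ∈ A → G.ε ∈ cl-τ A
    ε∈cl-τ A ε∈A = D , (λ _ → u) , (λ (js , h) → proj₁ (approximate u h)) ,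
      (λ _ → G.ε , ε∈A , Space.refl ELSpace) ,
      (λ js h → (js , h) , λ (js′ , h′) js≤js′ → js≤js′ (aut (proj₁ (approximate u h′))) (proj₂ (approximate u h′))) ,
      (λ js h → (mapᴸ shift js , All.map⁺ (All.map (λ {j} → shifted j) h)) , λ (js′ , h′) js≤js′ →
        All.map⁻ (js≤js′ (aut (proj₁ (approximate u h′))) (proj₂ (approximate u h′))))
      where
      shift : SS.Sub → SS.Sub
      shift (a , θ) = fn u ⟨$⟩ a , θ

      shifted : ∀ j → fn u SS.∋ j → fn u SS.∋ shift j
      shifted (a , θ) = ⇐ (pointwise u-idempotent a θ)

      D : DirectedSet ℓ
      D = record
        { Carrier = ∃[ js ] fn u SS.∋* js
        ; _≤_ = λ (js , _) (js′ , _) → ∀ (x : EL) → fn x SS.∋* js′ → fn x SS.∋* js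
        ; ≤-refl = λ _ → id
        ; ≤-trans = λ p q x → p x ∘ q x
        ; inhabited = [] , []
        ; directed = λ (js , h) (js′ , h′) → (js ++ js′ , ++⁺ h h′) ,
            (λ _ → proj₁ ∘ ++⁻ js) , (λ _ → proj₂ ∘ ++⁻ js)
        }

    ε∈H : G.ε ∈ H
    ε∈H V (U , _ , ε∈U , U⊆V) = ε∈cl-τ V (U⊆V ε∈U)

    private
      BaseAt : EL → Sub → Set ℓ
      BaseAt x θ = (fn x ⟨$⟩ base) ∋ θ

    -- ψ(x̄, ȳ) is consistent with p(tp(c̄/ℭ))(x̄) ∪ u(tp(c̄/ℭ))(ȳ).
    Related : OpenFormula L (∣ ℭ ∣ ⊎ ∣ ℭ ∣) → G.Carrier → Set ℓ
    Related ψ p = Limit ℭ-small ι id (λ _ → refl) (BaseAt (proj₁ p)) (BaseAt u) (_≡ ψ)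

    -- Since `uu = u`, automorphisms near `u` move `u(tp(c̄/ℭ))` only slightly. Applied to both
    -- members of a pair witnessing `Related ψ η`, they therefore give approximate witnesses for
    -- `p`.
    Related-closed : ∀ ψ p → cl-τ (Related ψ) p → Related ψ p
    Related-closed ψ p p∈cl =
      limitPair ℭ-small ι id (λ _ → refl) (BaseAt (proj₁ p)) (BaseAt u) (_≡ ψ) λ {js} {ks} hp hu hψ →
        let (g , η , (ρ , τ , hρ , hτ , h) , mη , mu) = cl-τ-approximate (Related ψ) p p∈cl hp
              (All.map (λ {θ} → ⇐ (pointwise u-idempotent base θ)) hu)
        in lifting g ∘ᴬ ρ , lifting g ∘ᴬ τ ,
           All.map (λ {θ} → ⇒ (Func.cong (actMap g) {fn (proj₁ η) ⟨$⟩ base} {point ρ}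
             (∋-⊆⇒≈ₛ {fn (proj₁ η) ⟨$⟩ base} {point ρ} hρ) θ)) mη ,
           All.map (λ {θ} → ⇒ (Func.cong (actMap g) {fn u ⟨$⟩ base} {point τ}
             (∋-⊆⇒≈ₛ {fn u ⟨$⟩ base} {point τ} hτ) θ)) mu ,
           Holds-lifting ι ρ τ g (All.map (λ {φ} → h φ) hψ)

    -- As `up = p`, automorphisms near `u` carry the pair `(f p, id)` close to the two prescribed
    -- types and preserve `ψ`.
    holds⇒Related : ∀ ψ p → Holds ℭ′ [ to (f p) ∘ ι , ι ] ψ → Related ψ p
    holds⇒Related ψ p h =
      limitPair ℭ-small ι id (λ _ → refl) (BaseAt (proj₁ p)) (BaseAt u) (_≡ ψ) λ {js} {ks} hp hu hψ →
        let (g , mp , mu) = approximate₂ u {fn (proj₁ p) ⟨$⟩ base} {base}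
              (All.map (λ {θ} → ⇐ (pointwise (u-identityˡ (proj₂ p)) base θ)) hp) hu
        in lifting g ∘ᴬ f p , lifting g ,
           All.map (λ {θ} → act∋⇒point∋ g (fn (proj₁ p) ⟨$⟩ base) θ) mp , mu ,
           Holds-lifting ι (f p) idᴬ g (All.map (λ { refl → h }) hψ)

    Unrelated : OpenFormula L (∣ ℭ ∣ ⊎ ∣ ℭ ∣) → G.Carrier → Set ℓ
    Unrelated ψ = ∁ (Related (negation ψ))

    Unrelated-neighbourhood : ∀ ψ → Thick ψ → Neighbourhood-τ G.ε (Unrelated ψ)
    Unrelated-neighbourhood ψ thick = Unrelated ψ ,
      -- `IsOpen-τ` concerns the complement of `Unrelated ψ`, which is the double negation of
      -- `Related (negation ψ)`.
      (λ {p} h ¬r → ¬r (Related-closed (negation ψ) p (cl-τ-mono (λ _ → ¬¬-elim) p h))) ,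
      (λ (ρ , τ , hρ , hτ , h) → ⇒ (Holds-negation ℭ′ [ to ρ ∘ ι , to τ ∘ ι ] ψ) (h (negation ψ) refl)
        (thick ρ τ λ θ → ⇔.trans (⇔.sym (∋-⊆⇒≈ₛ {fn u ⟨$⟩ base} {point ρ} hρ θ))
                                 (∋-⊆⇒≈ₛ {fn u ⟨$⟩ base} {point τ} hτ θ))) ,
      id

    Unrelated⇒holds : ∀ ψ p → Unrelated ψ p → Holds ℭ′ [ to (f p) ∘ ι , ι ] ψ
    Unrelated⇒holds ψ p ¬r = ¬¬-elim λ ¬h →
      ¬r (holds⇒Related (negation ψ) p (⇐ (Holds-negation ℭ′ [ to (f p) ∘ ι , ι ] ψ) ¬h))

    H⊆ker : ∀ p → p ∈ H → f p ~ idᴬ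
    H⊆ker p p∈H = conclude
      (limitPair ℭ-small ι id (λ _ → refl) (BaseAt (proj₁ p)) (BaseAt u) Thick λ {_} {_} {φs} hp hu hφ →
        -- A conjunction of thick formulas is thick, so one neighbourhood of `u` handles all of
        -- `φs`.
        let ψ = conjunction φs
            thick : Thick ψ
            thick = λ ρ τ eq → ⇐ (Holds-conjunction ℭ′ [ to ρ ∘ ι , to τ ∘ ι ] φs)
                                 (All.map (λ t → t ρ τ eq) hφ)
            (g , η , η∈W , mη , mu) = cl-τ-approximate (Unrelated ψ) p
              (p∈H (Unrelated ψ) (Unrelated-neighbourhood ψ thick)) hp hu
        in lifting g ∘ᴬ f η , lifting g ,
           All.map (λ {θ} → act∋⇒point∋ g (fn (proj₁ η) ⟨$⟩ base) θ) mη , mu ,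
           Holds-lifting ι (f η) idᴬ g
             (⇒ (Holds-conjunction ℭ′ [ to (f η) ∘ ι , ι ] φs) (Unrelated⇒holds ψ η η∈W)))
      where
      conclude : Limit ℭ-small ι id (λ _ → refl) (BaseAt (proj₁ p)) (BaseAt u) Thick → f p ~ idᴬ
      conclude (ρ , τ , hρ , hτ , h) = ~-trans {f p} {ρ} {idᴬ}
        (~-sym {ρ} {f p} (autOf-unique ρ (fn (proj₁ p) ⟨$⟩ base) hρ))
        (~-trans {ρ} {τ} {idᴬ} (thick⇒~ ρ τ h) (realizes-u τ hτ))

    -- Continuity of `f` and the induced epimorphism

    module _ (M : SmallSubmodel ℭ′ κ′) (m̄ : Enumeration (SmallSubmodel.model M)) where
      open SmallSubmodel M using (incl; small) renaming (model to M₀)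
      open Enumeration m̄ renaming (Index to Indexᴹ; tuple to m; surjective to m-surjective)

      private
        GalL = Gal-L stronglyHomogeneous M m̄
        module MS = Space (typeSpace M m̄)

        autOfᴹ : Realization M m̄ → Automorphism ℭ′
        autOfᴹ = typeToAut M m̄ stronglyHomogeneous

      autOf-translate : ∀ σ → autOfᴹ (translate M m̄ σ) ~ σ
      autOf-translate σ = agree⇒~ M (autOfᴹ (translate M m̄ σ)) σ λ x →
        subst (λ y → to (autOfᴹ (translate M m̄ σ)) (incl y) ≡ to σ (incl y)) (proj₂ (m-surjective x))
          (proj₂ (realizingAutomorphism M m̄ stronglyHomogeneous (translate M m̄ σ)) (proj₁ (m-surjective x)))

      f-continuous : IsContinuous u𝓜-τ GalL f
      f-continuous U (U-resp , U-open) {p} p∈cl Ufp = conclude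
        (limitPair K-small k̄ inj₁ (λ _ → refl) (BaseAt (proj₁ p)) (BaseAt u) Φ λ hp hu hφ →
          let (g , η , ¬Ufη , mη , mu) = cl-τ-approximate (∁ (U ∘ f)) p p∈cl hp hu in
          lifting g ∘ᴬ f η , lifting g ,
          All.map (λ {θ} → act∋⇒point∋ g (fn (proj₁ η) ⟨$⟩ base) θ) mη , mu ,
          Holds-lifting k̄ (f η) idᴬ g (All.map (λ {φ} → Φ-holds (f η) ¬Ufη φ) hφ))
        where
        -- The model that defines the topology of the Galois group need not lie inside ℭ, so the two
        -- are enumerated together.
        K : Set ℓ
        K = ∣ ℭ ∣ ⊎ ∣ M₀ ∣

        K-small : K <ᶜ κ′
        K-small = ⊎-<ᶜ strongLimit ℭ-small small

        k̄ : K → ∣ ℭ′ ∣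
        k̄ = [ ι , incl ]

        -- As U is open, these formulas axiomatize its complement.
        Closed : MS.Sub → Set ℓ
        Closed θ = ∀ a → ¬ U (autOfᴹ a) → a MS.∋ θ

        inK : Indexᴹ ⊎ ∣ M₀ ∣ → K ⊎ K
        inK = [ inj₁ ∘ inj₂ ∘ m , inj₂ ∘ inj₂ ]

        Φ : OpenFormula L (K ⊎ K) → Set ℓ
        Φ φ = ∃[ θ ] Closed θ × φ ≡ substitute inK θ

        -- The parameters from `M` are represented by their images under `τ`, and applying `τ⁻¹`
        -- restores them.
        inK-holds : ∀ ρ τ θ → Holds ℭ′ [ to ρ ∘ k̄ , to τ ∘ k̄ ] (substitute inK θ) ⇔
                    translate M m̄ (invᴬ τ ∘ᴬ ρ) MS.∋ θ
        inK-holds ρ τ θ = ⇔.trans (Holds-substitute ℭ′ inK [ to ρ ∘ k̄ , to τ ∘ k̄ ] θ)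
          (⇔.trans (Holds-to ℭ′ (invᴬ τ) ([ to ρ ∘ k̄ , to τ ∘ k̄ ] ∘ inK) θ)
            (mk⇔ (Holds-cong ℭ′ eq θ) (Holds-cong ℭ′ (sym ∘ eq) θ)))
          where
          eq : ∀ x → from τ ([ to ρ ∘ k̄ , to τ ∘ k̄ ] (inK x)) ≡ [ from τ ∘ to ρ ∘ incl ∘ m , incl ] x
          eq (inj₁ _) = refl
          eq (inj₂ b) = strictlyInverseʳ τ (incl b)

        Φ-holds : ∀ σ → ¬ U σ → ∀ φ → Φ φ → Holds ℭ′ [ to σ ∘ k̄ , k̄ ] φ
        Φ-holds σ ¬Uσ _ (θ , θ-closed , refl) = ⇐ (inK-holds σ idᴬ θ)
          (θ-closed (translate M m̄ σ) λ h → ¬Uσ (U-resp (autOf-translate σ) h))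

        -- Otherwise some basic neighbourhood of the type of `σ(m̄)` over `M` lies inside `U`, and
        -- the negation of its defining formula is in `Closed`.
        closed⇒∉U : ∀ σ → (∀ θ → Closed θ → translate M m̄ σ MS.∋ θ) → ¬ U σ
        closed⇒∉U σ h Uσ =
          let (js , σ∋js , js⊆U) = U-open {translate M m̄ σ}
                (U-resp (~-sym {autOfᴹ (translate M m̄ σ)} {σ} (autOf-translate σ)) Uσ)
          in ⇒ (Holds-negation ℭ′ (env σ) (conjunction js))
               (h (negation (conjunction js)) λ a ¬Ua →
                 ⇐ (Holds-negation ℭ′ [ Realization.tuple a , incl ] (conjunction js)) λ t →
                   ¬Ua (js⊆U {a} (⇒ (Holds-conjunction ℭ′ [ Realization.tuple a , incl ] js) t)))
               (⇐ (Holds-conjunction ℭ′ (env σ) js) σ∋js)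
          where
          env : Automorphism ℭ′ → Indexᴹ ⊎ ∣ M₀ ∣ → ∣ ℭ′ ∣
          env σ = [ to σ ∘ incl ∘ m , incl ]

        conclude : ¬ Limit K-small k̄ inj₁ (λ _ → refl) (BaseAt (proj₁ p)) (BaseAt u) Φ
        -- As `τ` represents 1, both `ρ` and `τ⁻¹ρ` represent `f p`.
        conclude (ρ , τ , hρ , hτ , h) = closed⇒∉U (invᴬ τ ∘ᴬ ρ)
          (λ θ θ-closed → ⇒ (inK-holds ρ τ θ) (h (substitute inK θ) (θ , θ-closed , refl)))
          (U-resp {f p} {invᴬ τ ∘ᴬ ρ} (~-trans {f p} {ρ} {invᴬ τ ∘ᴬ ρ}
            (~-sym {ρ} {f p} (autOf-unique ρ (fn (proj₁ p) ⟨$⟩ base) hρ))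
            (~-∙-cong {idᴬ} {invᴬ τ} {ρ} {ρ} (~-⁻¹-cong {idᴬ} {τ} (~-sym {τ} {idᴬ} (realizes-u τ hτ)))
              (~-refl {ρ}))) Ufp)

      f-coset : ∀ p q → LeftCoset G.rawGroup p H ≐ LeftCoset G.rawGroup q H → f p ~ f q
      f-coset p q (_ , q⊆p) =
        -- `q` belongs to its own coset because `u ∈ H`, and so to that of `p`.
        let (h , h∈H , q≈ph) = q⊆p {q} (G.ε , ε∈H , G.sym {q G.∙ G.ε} {q} (G.identityʳ q)) in
        ~-sym {f q} {f p} (~-trans {f q} {f (p G.∙ h)} {f p}
          (f̂-cong q≈ph)
          (~-trans {f (p G.∙ h)} {f p ∘ᴬ f h} {f p} (f̂-∙ (proj₁ p) (proj₁ h))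
            (~-trans {f p ∘ᴬ f h} {f p ∘ᴬ idᴬ} {f p} (~-∘ᴬ-congˡ (f p) {f h} {idᴬ} (H⊆ker h h∈H))
              (Gal.identityʳ (f p)))))

      f-⁻¹ : ∀ p → f (p G.⁻¹) ~ invᴬ (f p)
      f-⁻¹ p = GroupProperties.inverseˡ-unique galoisGroup (f (p G.⁻¹)) (f p)
        (~-trans {f (p G.⁻¹) ∘ᴬ f p} {f (p G.⁻¹ G.∙ p)} {idᴬ}
          (~-sym {f (p G.⁻¹ G.∙ p)} {f (p G.⁻¹) ∘ᴬ f p} (f̂-∙ (proj₁ (p G.⁻¹)) (proj₁ p)))
          (~-trans {f (p G.⁻¹ G.∙ p)} {f̂ u} {idᴬ} (f̂-cong (G.inverseˡ p)) f̂-u))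

      -- As `f̂ u` is trivial, a preimage `x` in EL can be replaced by `uxu`, which lies in `u𝓜`.
      f-surjective : ∀ σ → ∃[ p ] f p ~ σ
      f-surjective σ =
        let (x , fx~σ) = f̂-surjective σ in
        (u ∙ (x ∙ u) , x ∙ u , absorbs x u∈𝓜 , Space.refl ELSpace) ,
        ~-trans {f̂ (u ∙ (x ∙ u))} {f̂ u ∘ᴬ f̂ (x ∙ u)} {σ} (f̂-∙ u (x ∙ u))
          (~-∙-cong {f̂ u} {idᴬ} {f̂ (x ∙ u)} {σ} f̂-u
            (~-trans {f̂ (x ∙ u)} {f̂ x ∘ᴬ f̂ u} {σ} (f̂-∙ x u) (~-∙-cong {f̂ x} {σ} {f̂ u} {idᴬ} fx~σ f̂-u)))

      f̄-epimorphism : IsContinuousEpimorphism (u𝓜-τ / H) GalL f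
      f̄-epimorphism = record
        { homomorphism = record
          { isMonoidHomomorphism = record
            { isMagmaHomomorphism = record
              { isRelHomomorphism = record { cong = λ {p} {q} → f-coset p q }
              ; homo = λ p q → f̂-∙ (proj₁ p) (proj₁ q)
              }
            ; ε-homo = f̂-u
            }
          ; ⁻¹-homo = f-⁻¹
          }
        ; surjective = λ σ → let (p , fp~σ) = f-surjective σ in
            p , λ {q} q≈p → ~-trans {f q} {f p} {σ} (f-coset q p q≈p) fp~σ
        ; continuous = λ U U-open →
            (λ {p} {q} p≈q → proj₁ U-open {f p} {f q} (f-coset p q p≈q)) , λ {p} → f-continuous U U-open {p}
        }

theorem3p7 :
  (∀ a → ExcludedMiddle a) → (∀ a b → Extensionality a b) →
  ∀ {ℓ} {L : Language ℓ} (T : Theory L) → IsComplete T →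
  (P : MonsterPair T) (c̄ : Enumeration (MonsterPair.ℭ P)) →
  let open MonsterPair P
      open IsMonster ℭ′-monster using (stronglyHomogeneous)
      open Ellis P c̄ in
  (𝓜 : Pred EL ℓ) (𝓜-minimal : IsMinimalLeftIdeal 𝓜)
  (u : EL) (u∈𝓜 : u ∈ 𝓜) (u-idempotent : u ∙ u ≈ u)
  (M : SmallSubmodel ℭ′ κ′) (m̄ : Enumeration (SmallSubmodel.model M)) →
  let open EllisGroup 𝓜-minimal u∈𝓜 u-idempotent
      GalL = Gal-L stronglyHomogeneous M m̄
      GalKP = Gal-KP stronglyHomogeneous M m̄ in
  IsContinuous u𝓜-τ GalL f ×
  (∀ p → p ∈ H → TopGroup._≈_ GalL (f p) (TopGroup.ε GalL)) ×
  IsContinuousEpimorphism (u𝓜-τ / H) GalL f ×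
  IsContinuousEpimorphism u𝓜-τ (u𝓜-τ / H) id ×
  IsContinuousEpimorphism GalL GalKP id
theorem3p7 em ext _ _ P c̄ _ 𝓜-minimal _ u∈𝓜 u-idempotent M m̄ =
  (λ U U-open {p} → f-continuous 𝓜-minimal u∈𝓜 u-idempotent M m̄ U U-open {p}) ,
  H⊆ker 𝓜-minimal u∈𝓜 u-idempotent ,
  f̄-epimorphism 𝓜-minimal u∈𝓜 u-idempotent M m̄ ,
  quotient-map ellisGroup IsOpen-τ H ,
  quotient-map galoisGroup (TopGroup.IsOpen GalL) (closureOfIdentity GalL)
  where
  open MonsterPair P
  open IsMonster ℭ′-monster using (stronglyHomogeneous)
  open Ellis P c̄
  open EllisGroup 𝓜-minimal u∈𝓜 u-idempotent
  open Dynamics em ext P c̄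
  GalL = Gal-L stronglyHomogeneous M m̄
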